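{- Let $t \geq 5$ be an integer and let $G$ be a connected graph on $n$ vertices satisfying $\sigma_2(G) \geq \frac{t-3}{t-2}n$. If $G$ has no Hamiltonian path, then $n \geq 2t-4$, and moreover: (1) if $n > 2t-4$, then $G$ has an induced subgraph isomorphic to $K_{1,t}$; (2) if $n = 2t-4$, then $G$ is of the form $H \vee \overline{K}_{t-1}$ where $H$ is a graph on $t-3$ vertices.
   Context: All graphs are finite and simple. A Hamiltonian path of $G$ is a path containing all vertices of $G$. For a graph $G$, $\sigma_2(G)$ denotes the minimum of $\deg(x)+\deg(y)$ over all pairs of distinct nonadjacent vertices $x,y$ of $G$. $K_{1,t}$ denotes the star with one center vertex adjacent to $t$ pairwise nonadjacent leaves. $G \vee H$ denotes the join of graphs $G$ and $H$ (disjoint union plus all edges between $V(G)$ and $V(H)$), and $\overline{K}_{t-1}$ denotes the edgeless graph on $t-1$ vertices. -}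

module Defs where

open import Data.Empty using (⊥)
open import Data.Fin.Base using (Fin)
open import Data.Fin.Properties using (_≟_)
open import Data.Fin.Subset as Subset using (Subset)
open import Data.List.Base using (List; allFin; cartesianProduct; filter; length; map)
import Data.List.Extrema as Extrema
open import Data.List.Membership.Propositional using (_∈_)
open import Data.List.Relation.Unary.Linked using (Linked)
open import Data.List.Relation.Unary.Unique.Propositional using (Unique)
open import Data.Nat.Base using (ℕ; _+_; _≤_)
open import Data.Nat.Properties using (≤-isTotalOrder)
open import Data.Product.Base using (Σ-syntax; ∃-syntax; _×_; _,_; proj₁)
open import Data.Sum.Base using (_⊎_; inj₁; inj₂)
open import Data.Unit.Base using (⊤; tt)
open import Function.Bundles using (_↔_; _⇔_; Inverse)
open import Level using (0ℓ)
open import Relation.Binary.Bundles using (TotalOrder)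
open import Relation.Binary.Construct.Closure.ReflexiveTransitive using (Star)
open import Relation.Binary.Core using (Rel)
open import Relation.Binary.Definitions using (Decidable; Symmetric)
open import Relation.Nullary.Construct.Add.Supremum using (_⁺; ⊤⁺; [_])
open import Relation.Nullary.Decidable.Core using (yes; no; ¬?; _×-dec_)
open import Relation.Nullary.Negation.Core using (¬_)

open import Relation.Binary.Construct.Add.Supremum.NonStrict _≤_ public using (_≤⁺_; ≤⁺-isTotalOrder-≡)

-- Simple graphs on a vertex type V; a finite graph on n vertices is a
-- Graph (Fin n).
record Graph (V : Set) : Set₁ where
  field
    Adj    : Rel V 0ℓ
    adj?   : Decidable Adj
    sym    : Symmetric Adj
    irrefl : ∀ {v} → ¬ Adj v v

open Graph public

infix 4 _≅_

record _≅_ {V W : Set} (G : Graph V) (H : Graph W) : Set where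
  field
    bijection : V ↔ W
    adj⇔adj   : ∀ u v → Adj G u v ⇔ Adj H (Inverse.to bijection u) (Inverse.to bijection v)

edgeless : (V : Set) → Graph V
edgeless V = record
  { Adj    = λ _ _ → ⊥
  ; adj?   = λ _ _ → no (λ ())
  ; sym    = λ ()
  ; irrefl = λ ()
  }

infixr 6 _∨_

_∨_ : {V W : Set} → Graph V → Graph W → Graph (V ⊎ W)
_∨_ {V} {W} G H = record
  { Adj    = JoinAdj
  ; adj?   = joinAdj?
  ; sym    = λ {u} {v} → joinSym u v
  ; irrefl = λ {v} → joinIrrefl v
  }
  where
  JoinAdj : Rel (V ⊎ W) 0ℓ
  JoinAdj (inj₁ u) (inj₁ v) = Adj G u v
  JoinAdj (inj₁ _) (inj₂ _) = ⊤
  JoinAdj (inj₂ _) (inj₁ _) = ⊤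
  JoinAdj (inj₂ u) (inj₂ v) = Adj H u v

  joinAdj? : Decidable JoinAdj
  joinAdj? (inj₁ u) (inj₁ v) = adj? G u v
  joinAdj? (inj₁ _) (inj₂ _) = yes tt
  joinAdj? (inj₂ _) (inj₁ _) = yes tt
  joinAdj? (inj₂ u) (inj₂ v) = adj? H u v

  joinSym : ∀ u v → JoinAdj u v → JoinAdj v u
  joinSym (inj₁ _) (inj₁ _) p = sym G p
  joinSym (inj₁ _) (inj₂ _) _ = tt
  joinSym (inj₂ _) (inj₁ _) _ = tt
  joinSym (inj₂ _) (inj₂ _) p = sym H p

  joinIrrefl : ∀ v → ¬ JoinAdj v v
  joinIrrefl (inj₁ _) = irrefl G
  joinIrrefl (inj₂ _) = irrefl H

K₁,_ : (t : ℕ) → Graph (⊤ ⊎ Fin t)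
K₁, t = edgeless ⊤ ∨ edgeless (Fin t)

module _ {n : ℕ} (G : Graph (Fin n)) where

  inducedSubgraph : (S : Subset n) → Graph (Σ[ v ∈ Fin n ] v Subset.∈ S)
  inducedSubgraph S = record
    { Adj    = λ u v → Adj G (proj₁ u) (proj₁ v)
    ; adj?   = λ u v → adj? G (proj₁ u) (proj₁ v)
    ; sym    = sym G
    ; irrefl = irrefl G
    }

  HasInducedSubgraph : {W : Set} → Graph W → Set
  HasInducedSubgraph H = ∃[ S ] (inducedSubgraph S ≅ H)

  -- Connected graphs are nonempty. (The empty list counts as a path below, so
  -- the empty graph is not a connected graph without a Hamiltonian path under
  -- either convention.)
  Connected : Set
  Connected = Fin n × (∀ u v → Star (Adj G) u v)

  IsPath : List (Fin n) → Set
  IsPath vs = Linked (Adj G) vs × Unique vs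

  HasHamiltonianPath : Set
  HasHamiltonianPath = ∃[ vs ] (IsPath vs × (∀ v → v ∈ vs))

  deg : Fin n → ℕ
  deg v = length (filter (adj? G v) (allFin n))

  nonadjacentPairs : List (Fin n × Fin n)
  nonadjacentPairs =
    filter (λ (x , y) → ¬? (x ≟ y) ×-dec ¬? (adj? G x y))
           (cartesianProduct (allFin n) (allFin n))

ℕ⁺-totalOrder : TotalOrder 0ℓ 0ℓ 0ℓ
ℕ⁺-totalOrder = record { isTotalOrder = ≤⁺-isTotalOrder-≡ ≤-isTotalOrder }

-- The minimum over no pairs (complete graphs) is ⊤⁺ = ∞.
σ₂ : ∀ {n} → Graph (Fin n) → ℕ ⁺
σ₂ G = Extrema.min ℕ⁺-totalOrder ⊤⁺
         (map (λ (x , y) → [ deg G x + deg G y ]) (nonadjacentPairs G))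

{-# OPTIONS --safe #-}
module Submission where

-- Put k = t − 2.  The end vertices p, q of a longest path and a vertex v off it are
-- pairwise nonadjacent, so their degrees sum to at least n.  Scanning the path, this
-- forces a neighbour of q to be followed at distance two by a neighbour of p, which
-- gives a cycle Z missing exactly one vertex of the path.  The vertices off Z are then
-- independent, and together with the successors on Z of the neighbours of one of them,
-- v say, they form an independent set I of order deg v + |V ∖ Z|.  Choosing v with
-- 2k · deg v ≥ (k − 1) n, counting the edges between I and its complement gives n ≥ 2k,
-- the join structure when n = 2k, and a vertex with at least k + 2 neighbours in I when
-- n > 2k, except for k = 3 and n ∈ {9, 12}.  In these two cases a predecessor on Z of a
-- neighbour of v that lies outside I has too few neighbours in I, which again suffices.
open import Defs
open import Data.Bool.Base using (true)
open import Data.Empty using (⊥; ⊥-elim)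
open import Data.Fin.Base using (Fin; zero; suc)
open import Data.Fin.Properties using (¬∀⟶∃¬) renaming (_≟_ to _≟ᶠ_; any? to anyFin?)
import Data.Fin.Subset as Subset
open import Data.List.Base using (List; []; _∷_; _++_; allFin; filter; length; lookup; map; reverse; take)
import Data.List.Extrema as Extrema
open import Data.List.Membership.Propositional using (_∈_; _∉_; find; lose)
open import Data.List.Membership.Propositional.Properties using (∈-++⁺ˡ; ∈-++⁺ʳ; ∈-++⁻; ∈-allFin; ∈-cartesianProduct⁺; ∈-filter⁺; ∈-filter⁻; ∈-lookup; ∈-map⁺; ∈-map⁻; ∈-∃++)
open import Data.List.Membership.Propositional.Properties.WithK using (unique∧set⇒bag)
open import Data.List.Properties using (++-assoc; length-++; length-map; length-tabulate; length-take; map-++; take++drop≡id; unfold-reverse)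
open import Data.List.Relation.Binary.BagAndSetEquality using (∼bag⇒↭)
open import Data.List.Relation.Binary.Permutation.Propositional using (_↭_; ↭-prep; ↭-refl; ↭-reflexive; ↭-sym; ↭-trans; ↭⇒↭ₛ)
import Data.List.Relation.Binary.Permutation.Propositional.Properties as ↭ₚ
import Data.List.Relation.Binary.Permutation.Setoid.Properties as ↭ₛₚ
open import Data.List.Relation.Unary.All as All using (All; []; _∷_)
import Data.List.Relation.Unary.All.Properties as Allₚ
open import Data.List.Relation.Unary.AllPairs as AllPairs using ([]; _∷_)
import Data.List.Relation.Unary.AllPairs.Properties as AllPairsₚ
open import Data.List.Relation.Unary.Any using (any?; here; index; there)
open import Data.List.Relation.Unary.Any.Properties using (lookup-index)
open import Data.List.Relation.Unary.Linked as Linked using (Linked; [-]; _∷_)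
open import Data.List.Relation.Unary.Unique.DecPropositional using (unique?)
open import Data.List.Relation.Unary.Unique.Propositional using (Unique)
import Data.List.Relation.Unary.Unique.Propositional.Properties as Uniqueₚ
open import Data.Maybe.Base as Maybe using ()
open import Data.Nat.Base
open import Data.Nat.ListAction using (sum)
open import Data.Nat.ListAction.Properties using (sum-++; sum-↭)
open import Data.Nat.Properties
open import Data.Nat.Tactic.RingSolver using (solve-∀)
open import Data.Product.Base using (_×_; _,_; proj₁; proj₂; Σ-syntax; ∃-syntax)
open import Data.Sum.Base using (_⊎_; inj₁; inj₂; map₂)
open import Data.Unit.Base using (⊤; tt)
open import Data.Vec.Base using (tabulate)
open import Data.Vec.Properties using (lookup∘tabulate; lookup⇒[]=; []=⇒lookup)
open import Data.Vec.Properties.WithK using ([]=-irrelevant)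
open import Function.Base using (_∘_)
open import Function.Bundles using (_⇔_; Equivalence; mk⇔; mk↔ₛ′)
open import Relation.Binary.Construct.Closure.ReflexiveTransitive using (Star; ε; _◅_)
open import Relation.Binary.Construct.Add.Supremum.NonStrict _≤_ using ([≤]-injective)
open import Relation.Binary.PropositionalEquality using (_≡_; _≢_; cong; cong₂; module ≡-Reasoning; refl; setoid; subst; subst₂; trans) renaming (sym to ≡-sym)
open import Relation.Nullary using (Dec; does; map′; no; yes; _×-dec_; ¬?; ¬_)
open import Relation.Nullary.Construct.Add.Supremum using ([_]; ⊤⁺)
open import Relation.Nullary.Decidable using (dec-true; decidable-stable)
open import Relation.Unary using (Decidable)

Unique-resp-↭ : ∀ {A : Set} {xs ys : List A} → xs ↭ ys → Unique xs → Unique ys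
Unique-resp-↭ {A} p = ↭ₛₚ.Unique-resp-↭ (setoid A) (↭⇒↭ₛ p)

⟦_⟧ : ∀ {P : Set} → Dec P → ℕ
⟦ yes _ ⟧ = 1
⟦ no _ ⟧  = 0

⟦⟧≤1 : ∀ {P : Set} (P? : Dec P) → ⟦ P? ⟧ ≤ 1
⟦⟧≤1 (yes _) = ≤-refl
⟦⟧≤1 (no _)  = z≤n

⟦⟧≡0 : ∀ {P : Set} (P? : Dec P) → ¬ P → ⟦ P? ⟧ ≡ 0
⟦⟧≡0 (yes p) ¬p = ⊥-elim (¬p p)
⟦⟧≡0 (no _)  _  = refl

⟦⟧-cong : ∀ {P Q : Set} (P? : Dec P) (Q? : Dec Q) → (P → Q) → (Q → P) → ⟦ P? ⟧ ≡ ⟦ Q? ⟧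
⟦⟧-cong (yes _) (yes _) _ _ = refl
⟦⟧-cong (yes p) (no ¬q) f _ = ⊥-elim (¬q (f p))
⟦⟧-cong (no ¬p) (yes q) _ g = ⊥-elim (¬p (g q))
⟦⟧-cong (no _)  (no _)  _ _ = refl

module _ {A : Set} where

  ∑ : (A → ℕ) → List A → ℕ
  ∑ f xs = sum (map f xs)

  ∑-++ : ∀ f xs ys → ∑ f (xs ++ ys) ≡ ∑ f xs + ∑ f ys
  ∑-++ f xs ys = trans (cong sum (map-++ f xs ys)) (sum-++ (map f xs) (map f ys))

  ∑-↭ : ∀ f {xs ys} → xs ↭ ys → ∑ f xs ≡ ∑ f ys
  ∑-↭ f p = sum-↭ (↭ₚ.map⁺ f p)

  ∑-mono : ∀ {f g} xs → (∀ {x} → x ∈ xs → f x ≤ g x) → ∑ f xs ≤ ∑ g xs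
  ∑-mono []       _ = z≤n
  ∑-mono (x ∷ xs) h = +-mono-≤ (h (here refl)) (∑-mono xs (h ∘ there))

  ∑-cong : ∀ {f g} xs → (∀ {x} → x ∈ xs → f x ≡ g x) → ∑ f xs ≡ ∑ g xs
  ∑-cong []       _ = refl
  ∑-cong (x ∷ xs) h = cong₂ _+_ (h (here refl)) (∑-cong xs (h ∘ there))

  ∑-const : ∀ c xs → ∑ (λ _ → c) xs ≡ length xs * c
  ∑-const c []       = refl
  ∑-const c (_ ∷ xs) = cong (c +_) (∑-const c xs)

  ∑-zero : ∀ {f} xs → (∀ {x} → x ∈ xs → f x ≡ 0) → ∑ f xs ≡ 0
  ∑-zero xs h = trans (∑-cong xs h) (trans (∑-const 0 xs) (*-zeroʳ (length xs)))

  ∑-bound : ∀ {f c} xs → (∀ {x} → x ∈ xs → f x ≤ c) → ∑ f xs ≤ length xs * c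
  ∑-bound {f} {c} xs h = subst (∑ f xs ≤_) (∑-const c xs) (∑-mono xs h)

  ∑-bound-at : ∀ {f c x} xs → (∀ {y} → y ∈ xs → f y ≤ c) → x ∈ xs →
              ∑ f xs + c ≤ f x + length xs * c
  ∑-bound-at {f} {c} (y ∷ xs) h (here refl) = begin
    f y + ∑ f xs + c          ≡⟨ trans (+-assoc (f y) _ c) (cong (f y +_) (+-comm _ c)) ⟩
    f y + (c + ∑ f xs)        ≤⟨ +-monoʳ-≤ (f y) (+-monoʳ-≤ c (∑-bound xs (h ∘ there))) ⟩
    f y + (c + length xs * c) ∎
    where open ≤-Reasoning
  ∑-bound-at {f} {c} {x} (y ∷ xs) h (there x∈) = begin
    f y + ∑ f xs + c          ≡⟨ +-assoc (f y) _ c ⟩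
    f y + (∑ f xs + c)        ≤⟨ +-mono-≤ (h (here refl)) (∑-bound-at xs (h ∘ there) x∈) ⟩
    c + (f x + length xs * c) ≡⟨ lemma c (f x) (length xs * c) ⟩
    f x + (c + length xs * c) ∎
    where
    open ≤-Reasoning
    lemma : ∀ a b d → a + (b + d) ≡ b + (a + d)
    lemma = solve-∀

  ∑-+ : ∀ f g xs → ∑ (λ x → f x + g x) xs ≡ ∑ f xs + ∑ g xs
  ∑-+ f g []       = refl
  ∑-+ f g (x ∷ xs) = trans (cong (f x + g x +_) (∑-+ f g xs)) (lemma (f x) (g x) (∑ f xs) (∑ g xs))
    where
    lemma : ∀ a b c d → a + b + (c + d) ≡ a + c + (b + d)
    lemma = solve-∀

  ∑-* : ∀ c f xs → ∑ (λ x → c * f x) xs ≡ c * ∑ f xs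
  ∑-* c f []       = ≡-sym (*-zeroʳ c)
  ∑-* c f (x ∷ xs) = trans (cong (c * f x +_) (∑-* c f xs)) (≡-sym (*-distribˡ-+ c (f x) (∑ f xs)))

  length-filter≡∑ : ∀ {P : A → Set} (P? : Decidable P) xs → length (filter P? xs) ≡ ∑ (λ x → ⟦ P? x ⟧) xs
  length-filter≡∑ P? []       = refl
  length-filter≡∑ P? (x ∷ xs) with P? x
  ... | yes _ = cong suc (length-filter≡∑ P? xs)
  ... | no _  = length-filter≡∑ P? xs

  ∑-full : ∀ {P : A → Set} (P? : Decidable P) xs → length xs ≤ ∑ (λ x → ⟦ P? x ⟧) xs →
           ∀ {x} → x ∈ xs → P x
  ∑-full P? xs h {x} x∈ with P? x in eq
  ... | yes p = p
  ... | no _  = ⊥-elim (<-irrefl refl (begin-strict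
    length xs                        ≤⟨ h ⟩
    ∑ (λ y → ⟦ P? y ⟧) xs            <⟨ m<m+n _ z<s ⟩
    ∑ (λ y → ⟦ P? y ⟧) xs + 1        ≤⟨ ∑-bound-at xs (λ {y} _ → ⟦⟧≤1 (P? y)) x∈ ⟩
    ⟦ P? x ⟧ + length xs * 1         ≡⟨ cong₂ _+_ (cong ⟦_⟧ eq) (*-identityʳ _) ⟩
    length xs                        ∎))
    where open ≤-Reasoning

∑-swap : ∀ {A B : Set} (f : A → B → ℕ) xs ys → ∑ (λ x → ∑ (f x) ys) xs ≡ ∑ (λ y → ∑ (λ x → f x y) xs) ys
∑-swap f []       ys = ≡-sym (∑-zero ys (λ _ → refl))
∑-swap f (x ∷ xs) ys = trans (cong (∑ (f x) ys +_) (∑-swap f xs ys)) (≡-sym (∑-+ (f x) (λ y → ∑ (λ x → f x y) xs) ys))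

∑-map : ∀ {A B : Set} (f : B → ℕ) (g : A → B) xs → ∑ (f ∘ g) xs ≡ ∑ f (map g xs)
∑-map f g []       = refl
∑-map f g (x ∷ xs) = cong (f (g x) +_) (∑-map f g xs)

-- Peeling off two elements at a time, we end with two or three elements, where the pairwise
-- bounds can be averaged.
pairwise-∑ : ∀ {A : Set} (f : A → ℕ) c xs → length xs ≢ 1 → Unique xs →
             (∀ {x y} → x ∈ xs → y ∈ xs → x ≢ y → c ≤ f x + f y) → length xs * c ≤ 2 * ∑ f xs
pairwise-∑ f c []              _  _ _ = z≤n
pairwise-∑ f c (_ ∷ [])        l≢ _ _ = ⊥-elim (l≢ refl)
pairwise-∑ f c (x ∷ y ∷ z ∷ []) _ ((x≢y ∷ x≢z ∷ []) ∷ (y≢z ∷ []) ∷ _) h = begin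
  3 * c                                     ≡⟨ cong (c +_) (cong (c +_) (+-identityʳ c)) ⟩
  c + (c + c)                               ≤⟨ +-mono-≤ (h x∈ y∈ x≢y) (+-mono-≤ (h x∈ z∈ x≢z) (h y∈ z∈ y≢z)) ⟩
  f x + f y + (f x + f z + (f y + f z))     ≡⟨ lemma (f x) (f y) (f z) ⟩
  2 * (f x + (f y + (f z + 0)))             ∎
  where
  open ≤-Reasoning
  x∈ = here refl
  y∈ = there (here refl)
  z∈ = there (there (here refl))
  lemma : ∀ a b d → a + b + (a + d + (b + d)) ≡ 2 * (a + (b + (d + 0)))
  lemma = solve-∀
pairwise-∑ f c (x ∷ y ∷ []) _ ((x≢y ∷ _) ∷ _) h = begin
  2 * c                                     ≤⟨ *-monoʳ-≤ 2 (h (here refl) (there (here refl)) x≢y) ⟩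
  2 * (f x + f y)                           ≡⟨ cong (λ w → 2 * (f x + w)) (+-identityʳ (f y)) ⟨
  2 * (f x + (f y + 0))                     ∎
  where open ≤-Reasoning
pairwise-∑ f c (x ∷ y ∷ zs@(_ ∷ _ ∷ _)) _ ((x≢y ∷ _) ∷ _ ∷ u) h = begin
  c + (c + length zs * c)                   ≡⟨ lemma c (length zs * c) ⟩
  2 * c + length zs * c                     ≤⟨ +-mono-≤ (*-monoʳ-≤ 2 (h (here refl) (there (here refl)) x≢y)) rest ⟩
  2 * (f x + f y) + 2 * ∑ f zs              ≡⟨ lemma′ (f x) (f y) (∑ f zs) ⟩
  2 * (f x + (f y + ∑ f zs))                ∎
  where
  open ≤-Reasoning
  rest : length zs * c ≤ 2 * ∑ f zs
  rest = pairwise-∑ f c zs (λ ()) u (λ p q → h (there (there p)) (there (there q)))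
  lemma : ∀ a b → a + (a + b) ≡ 2 * a + b
  lemma = solve-∀
  lemma′ : ∀ a b d → 2 * (a + b) + 2 * d ≡ 2 * (a + (b + d))
  lemma′ = solve-∀

module _ {n : ℕ} where

  open import Data.List.Membership.DecPropositional (_≟ᶠ_ {n}) using (_∈?_)

  others : List (Fin n) → List (Fin n)
  others xs = filter (λ x → ¬? (x ∈? xs)) (allFin n)

  ∈-others⁺ : ∀ {x xs} → x ∉ xs → x ∈ others xs
  ∈-others⁺ {x} = ∈-filter⁺ _ (∈-allFin x)

  ∈-others⁻ : ∀ {x xs} → x ∈ others xs → x ∉ xs
  ∈-others⁻ {xs = xs} x∈ = proj₂ (∈-filter⁻ (λ x → ¬? (x ∈? xs)) {xs = allFin n} x∈)

  others-unique : ∀ xs → Unique (others xs)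
  others-unique xs = Uniqueₚ.filter⁺ _ (Uniqueₚ.allFin⁺ n)

  allFin-↭ : ∀ {xs} → Unique xs → allFin n ↭ xs ++ others xs
  allFin-↭ {xs} u = ∼bag⇒↭ (unique∧set⇒bag (Uniqueₚ.allFin⁺ n)
    (Uniqueₚ.++⁺ u (others-unique xs) (λ (p , q) → ∈-others⁻ q p))
    (λ {x} → mk⇔ (λ _ → split x) (λ _ → ∈-allFin x)))
    where
    split : ∀ x → x ∈ xs ++ others xs
    split x with x ∈? xs
    ... | yes p = ∈-++⁺ˡ p
    ... | no ¬p = ∈-++⁺ʳ xs (∈-others⁺ ¬p)

  length-others : ∀ {xs} → Unique xs → length xs + length (others xs) ≡ n
  length-others {xs} u = begin
    length xs + length (others xs) ≡⟨ length-++ xs ⟨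
    length (xs ++ others xs)       ≡⟨ ↭ₚ.↭-length (allFin-↭ u) ⟨
    length (allFin n)              ≡⟨ length-tabulate _ ⟩
    n                              ∎
    where open ≡-Reasoning

length-⊆ : ∀ {A : Set} {xs ys : List A} → Unique xs → (∀ {x} → x ∈ xs → x ∈ ys) → length xs ≤ length ys
length-⊆ {xs = []}     _       _ = z≤n
length-⊆ {xs = x ∷ xs} (x∉ ∷ u) h with ∈-∃++ (h (here refl))
... | as , bs , refl = begin
  suc (length xs)          ≤⟨ s≤s (length-⊆ u xs⊆) ⟩
  suc (length (as ++ bs))  ≡⟨ ↭ₚ.↭-length (↭ₚ.shift x as bs) ⟨
  length (as ++ x ∷ bs)    ∎
  where
  open ≤-Reasoning
  xs⊆ : ∀ {y} → y ∈ xs → y ∈ as ++ bs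
  xs⊆ y∈ with ↭ₚ.∈-resp-↭ (↭ₚ.shift x as bs) (h (there y∈))
  ... | here refl = ⊥-elim (All.lookup x∉ y∈ refl)
  ... | there p   = p

steps : ∀ {A : Set} → List A → List (A × A)
steps (x ∷ xs@(y ∷ _)) = (x , y) ∷ steps xs
steps _                = []

steps-proj₂ : ∀ {A : Set} (x : A) xs → map proj₂ (steps (x ∷ xs)) ≡ xs
steps-proj₂ x []       = refl
steps-proj₂ x (y ∷ xs) = cong (y ∷_) (steps-proj₂ y xs)

∉⇒All≢ : ∀ {A : Set} {x : A} {xs} → x ∉ xs → All (x ≢_) xs
∉⇒All≢ = Allₚ.¬Any⇒All¬ _

listOfLength? : ∀ {n} {Q : List (Fin n) → Set} → Decidable Q → ∀ j → Dec (∃[ xs ] (length xs ≡ j × Q xs))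
listOfLength? Q? zero = map′ (λ q → [] , refl , q) (λ { ([] , _ , q) → q }) (Q? [])
listOfLength? Q? (suc j) = map′
  (λ { (x , xs , eq , q) → x ∷ xs , cong suc eq , q })
  (λ { (x ∷ xs , eq , q) → x , xs , suc-injective eq , q })
  (anyFin? (λ x → listOfLength? (λ xs → Q? (x ∷ xs)) j))

unique-map-injective : ∀ {A B : Set} (f : A → B) {xs} → Unique (map f xs) →
                       ∀ {x y} → x ∈ xs → y ∈ xs → f x ≡ f y → x ≡ y
unique-map-injective f (_ ∷ _)  (here refl) (here refl) _  = refl
unique-map-injective f (p ∷ _)  (here refl) (there y∈)  eq = ⊥-elim (All.lookup p (∈-map⁺ f y∈) eq)
unique-map-injective f (p ∷ _)  (there x∈)  (here refl) eq = ⊥-elim (All.lookup p (∈-map⁺ f x∈) (≡-sym eq))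
unique-map-injective f (_ ∷ u)  (there x∈)  (there y∈)  eq = unique-map-injective f u x∈ y∈ eq

unique-map-filter : ∀ {A B : Set} (f : A → B) {P : A → Set} (P? : Decidable P) {xs} →
                    Unique (map f xs) → Unique (map f (filter P? xs))
unique-map-filter f P? u = AllPairsₚ.map⁺ (AllPairsₚ.filter⁺ P? (AllPairsₚ.map⁻ u))

lookup-injective : ∀ {A : Set} {xs : List A} → Unique xs → ∀ {i j} → lookup xs i ≡ lookup xs j → i ≡ j
lookup-injective (_ ∷ _) {zero}  {zero}  _  = refl
lookup-injective (p ∷ _) {zero}  {suc j} eq = ⊥-elim (All.lookup p (∈-lookup j) eq)
lookup-injective (p ∷ _) {suc i} {zero}  eq = ⊥-elim (All.lookup p (∈-lookup i) (≡-sym eq))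
lookup-injective (_ ∷ u) {suc i} {suc j} eq = cong suc (lookup-injective u eq)

does-true : ∀ {P : Set} (P? : Dec P) → does P? ≡ true → P
does-true (yes p) _ = p

*≤⇒≤ : ∀ c {a m b} → a * c ≤ b → b < suc m * c → a ≤ m
*≤⇒≤ c {a} {m} h b< = s≤s⁻¹ (*-cancelʳ-< c a (suc m) (≤-<-trans h b<))

≤*⇒≤ : ∀ c {a m b} → b ≤ c * a → c * m < b → suc m ≤ a
≤*⇒≤ c {a} {m} h <b = *-cancelˡ-< c m a (<-≤-trans <b h)

squeeze : ∀ {a b c d} → a ≤ c → b ≤ d → c + d ≤ a + b → c ≡ a × d ≡ b
squeeze {a} {b} {c} {d} a≤c b≤d h =
  ≤-antisym (+-cancelʳ-≤ d c a (≤-trans h (+-monoʳ-≤ a b≤d))) a≤c ,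
  ≤-antisym (+-cancelˡ-≤ c d b (≤-trans h (+-monoˡ-≤ b a≤c))) b≤d

-- Here k = 3 + i, and r + z is the order of an independent set (r vertices off the cycle and
-- z = deg v successors of neighbours of v) of total degree D; w is the number of other vertices.
module _ {i n z r w D : ℕ} (hz : (2 + i) * n ≤ 2 * (3 + i) * z) (2≤r : 2 ≤ r) (n≡ : r + z + w ≡ n)
         (lower : (r + z) * ((2 + i) * n) ≤ 2 * ((3 + i) * D)) (upper : D ≤ w * (4 + i)) where

  order-bound : (r + z) * ((2 + i) * n + 2 * ((3 + i) * (4 + i))) ≤ 2 * ((3 + i) * (4 + i)) * n
  order-bound = begin
    (r + z) * ((2 + i) * n + 2 * ((3 + i) * (4 + i)))             ≡⟨ *-distribˡ-+ (r + z) ((2 + i) * n) _ ⟩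
    (r + z) * ((2 + i) * n) + (r + z) * (2 * ((3 + i) * (4 + i))) ≤⟨ +-monoˡ-≤ _ lower ⟩
    2 * ((3 + i) * D) + (r + z) * (2 * ((3 + i) * (4 + i)))       ≤⟨ +-monoˡ-≤ _ (*-monoʳ-≤ 2 (*-monoʳ-≤ (3 + i) upper)) ⟩
    2 * ((3 + i) * (w * (4 + i))) + (r + z) * (2 * ((3 + i) * (4 + i))) ≡⟨ lemma (3 + i) (4 + i) w (r + z) ⟩
    2 * ((3 + i) * (4 + i)) * (r + z + w)                         ≡⟨ cong (2 * ((3 + i) * (4 + i)) *_) n≡ ⟩
    2 * ((3 + i) * (4 + i)) * n                                   ∎
    where
    open ≤-Reasoning
    lemma : ∀ a b w s → 2 * (a * (w * b)) + s * (2 * (a * b)) ≡ 2 * (a * b) * (s + w)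
    lemma = solve-∀

  quadratic-bound : ((2 + i) * n + 4 * (3 + i)) * ((2 + i) * n + 2 * ((3 + i) * (4 + i))) ≤
                    4 * ((3 + i) * (3 + i) * (4 + i)) * n
  quadratic-bound = begin
    ((2 + i) * n + 4 * (3 + i)) * F              ≡⟨ cong (λ x → ((2 + i) * n + x) * F) (lemma (3 + i)) ⟩
    ((2 + i) * n + 2 * (3 + i) * 2) * F          ≤⟨ *-monoˡ-≤ F (+-mono-≤ hz (*-monoʳ-≤ (2 * (3 + i)) 2≤r)) ⟩
    (2 * (3 + i) * z + 2 * (3 + i) * r) * F      ≡⟨ lemma₁ (3 + i) z r F ⟩
    2 * (3 + i) * ((r + z) * F)                  ≤⟨ *-monoʳ-≤ (2 * (3 + i)) order-bound ⟩
    2 * (3 + i) * (2 * ((3 + i) * (4 + i)) * n)  ≡⟨ lemma₂ (3 + i) (4 + i) n ⟩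
    4 * ((3 + i) * (3 + i) * (4 + i)) * n        ∎
    where
    open ≤-Reasoning
    F : ℕ
    F = (2 + i) * n + 2 * ((3 + i) * (4 + i))
    lemma : ∀ a → 4 * a ≡ 2 * a * 2
    lemma = solve-∀
    lemma₁ : ∀ a z r f → (2 * a * z + 2 * a * r) * f ≡ 2 * a * ((r + z) * f)
    lemma₁ = solve-∀
    lemma₂ : ∀ a b n → 2 * a * (2 * (a * b) * n) ≡ 4 * (a * a * b) * n
    lemma₂ = solve-∀

-- The two sides of quadratic-bound differ by (n - 2k)((k - 1)² n - 4k(k + 1)).
k≥4-impossible : ∀ j l {n} → n ≡ 9 + 2 * j + l →
  ¬ (((3 + j) * n + 4 * (4 + j)) * ((3 + j) * n + 2 * ((4 + j) * (5 + j))) ≤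
     4 * ((4 + j) * (4 + j) * (5 + j)) * n)
k≥4-impossible j l refl h = m+1+n≰m _ (≤-trans (≤-reflexive (≡-sym (identity j l))) h)
  where
  identity : ∀ j l →
    ((3 + j) * (9 + 2 * j + l) + 4 * (4 + j)) * ((3 + j) * (9 + 2 * j + l) + 2 * ((4 + j) * (5 + j))) ≡
    4 * ((4 + j) * (4 + j) * (5 + j)) * (9 + 2 * j + l) +
    suc (36 * j + 9 * l + 17 * (j * j) + 6 * (j * l) + 2 * (j * j * j) + j * j * l +
         l * (1 + 36 * j + 9 * l + 17 * (j * j) + 6 * (j * l) + 2 * (j * j * j) + j * j * l))
  identity = solve-∀

k≡3-impossible : ∀ l → ¬ ((2 * (13 + l) + 12) * (2 * (13 + l) + 24) ≤ 144 * (13 + l))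
k≡3-impossible l h = m+1+n≰m _ (≤-trans (≤-reflexive (≡-sym (identity l))) h)
  where
  identity : ∀ l → (2 * (13 + l) + 12) * (2 * (13 + l) + 24) ≡
                   144 * (13 + l) + suc (27 + 32 * l + 4 * (l * l))
  identity = solve-∀

Exceptional : ℕ → ℕ → ℕ → ℕ → Set
Exceptional i n z r = i ≡ 0 × ((n ≡ 9 × z ≡ 3 × r ≡ 2) ⊎ (n ≡ 12 × z ≡ 4 × r ≡ 2))

few-exceptions : ∀ i n {z r w D} → (2 + i) * n ≤ 2 * (3 + i) * z → 2 ≤ r → r + z + w ≡ n → 6 + 2 * i < n →
  (r + z) * ((2 + i) * n) ≤ 2 * ((3 + i) * D) → D ≤ w * (4 + i) → Exceptional i n z r
few-exceptions (suc j) n {z} {r} {w} {D} hz 2≤r n≡ n> lower upper =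
  ⊥-elim (k≥4-impossible j (n ∸ (9 + 2 * j)) (≡-sym (m+[n∸m]≡n (≤-trans (≤-reflexive (lemma j)) n>)))
    (quadratic-bound {i = suc j} {D = D} hz 2≤r n≡ lower upper))
  where
  lemma : ∀ j → 9 + 2 * j ≡ suc (6 + 2 * suc j)
  lemma = solve-∀
few-exceptions zero n {z} {r} {w} {D} hz 2≤r n≡ n> lower upper =
  refl , small n hz (order-bound {i = 0} {D = D} hz 2≤r n≡ lower upper) n>
    (λ l eq → k≡3-impossible l (subst (λ n → (2 * n + 12) * (2 * n + 24) ≤ 144 * n) eq
      (quadratic-bound {i = 0} {D = D} hz 2≤r n≡ lower upper)))
  where
  small : ∀ n → 2 * n ≤ 6 * z → (r + z) * (2 * n + 24) ≤ 24 * n → 6 < n →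
          (∀ l → n ≡ 13 + l → ⊥) → (n ≡ 9 × z ≡ 3 × r ≡ 2) ⊎ (n ≡ 12 × z ≡ 4 × r ≡ 2)
  clash : ∀ {a b} → suc a ≤ z → r + z ≤ b → b < suc (suc (suc a)) → ⊥
  clash z≥ s≤ b< = <⇒≱ b< (≤-trans (+-mono-≤ 2≤r z≥) s≤)
  small 7  hz hs _ _ = ⊥-elim (clash (≤*⇒≤ 6 {m = 2} hz (<ᵇ⇒< _ _ tt)) (*≤⇒≤ 38 {m = 4} hs (<ᵇ⇒< _ _ tt)) (<ᵇ⇒< _ _ tt))
  small 8  hz hs _ _ = ⊥-elim (clash (≤*⇒≤ 6 {m = 2} hz (<ᵇ⇒< _ _ tt)) (*≤⇒≤ 40 {m = 4} hs (<ᵇ⇒< _ _ tt)) (<ᵇ⇒< _ _ tt))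
  small 9  hz hs _ _ with squeeze 2≤r (≤*⇒≤ 6 {m = 2} hz (<ᵇ⇒< _ _ tt)) (*≤⇒≤ 42 {m = 5} hs (<ᵇ⇒< _ _ tt))
  ... | r≡ , z≡ = inj₁ (refl , z≡ , r≡)
  small 10 hz hs _ _ = ⊥-elim (clash (≤*⇒≤ 6 {m = 3} hz (<ᵇ⇒< _ _ tt)) (*≤⇒≤ 44 {m = 5} hs (<ᵇ⇒< _ _ tt)) (<ᵇ⇒< _ _ tt))
  small 11 hz hs _ _ = ⊥-elim (clash (≤*⇒≤ 6 {m = 3} hz (<ᵇ⇒< _ _ tt)) (*≤⇒≤ 46 {m = 5} hs (<ᵇ⇒< _ _ tt)) (<ᵇ⇒< _ _ tt))
  small 12 hz hs _ _ with squeeze 2≤r (≤*⇒≤ 6 {m = 3} hz (<ᵇ⇒< _ _ tt)) (*≤⇒≤ 48 {m = 6} hs (<ᵇ⇒< _ _ tt))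
  ... | r≡ , z≡ = inj₂ (refl , z≡ , r≡)
  small (suc (suc (suc (suc (suc (suc (suc (suc (suc (suc (suc (suc (suc l))))))))))))) _ _ _ big = ⊥-elim (big l refl)
  small 0 _ _ () _
  small 1 _ _ (s≤s ()) _
  small 2 _ _ (s≤s (s≤s ())) _
  small 3 _ _ (s≤s (s≤s (s≤s ()))) _
  small 4 _ _ (s≤s (s≤s (s≤s (s≤s ())))) _
  small 5 _ _ (s≤s (s≤s (s≤s (s≤s (s≤s ()))))) _
  small 6 _ _ (s≤s (s≤s (s≤s (s≤s (s≤s (s≤s ())))))) _

-- In the exceptional cases one of the w vertices has only e neighbours in the independent set.
exceptions-impossible : ∀ {i n z r w D e L} → Exceptional i n z r → r + z + w ≡ n → L + r ≡ n →
  (r + z) * ((2 + i) * n) ≤ 2 * ((3 + i) * D) → D + (4 + i) ≤ e + w * (4 + i) → e + (z + z) ≤ L → ⊥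
exceptions-impossible {w = w} {D} {e} {L} (refl , inj₁ (refl , refl , refl)) n≡ L≡ lower upper e≤
  with refl ← +-cancelˡ-≡ 5 w 4 n≡ | refl ← +-cancelʳ-≡ 2 L 7 L≡ =
  <⇒≱ (<ᵇ⇒< 17 19 tt) (begin
    15 + 4      ≤⟨ +-monoˡ-≤ 4 (*-cancelˡ-≤ {15} {D} 6 (≤-trans lower (≤-reflexive (lemma D)))) ⟩
    D + 4       ≤⟨ upper ⟩
    e + 16      ≤⟨ +-monoˡ-≤ 16 (+-cancelʳ-≤ 6 e 1 e≤) ⟩
    17          ∎)
  where
  open ≤-Reasoning
  lemma : ∀ D → 2 * (3 * D) ≡ 6 * D
  lemma = solve-∀
exceptions-impossible {w = w} {D} {e} {L} (refl , inj₂ (refl , refl , refl)) n≡ L≡ lower upper e≤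
  with refl ← +-cancelˡ-≡ 6 w 6 n≡ | refl ← +-cancelʳ-≡ 2 L 10 L≡ =
  <⇒≱ (<ᵇ⇒< 26 28 tt) (begin
    24 + 4      ≤⟨ +-monoˡ-≤ 4 (*-cancelˡ-≤ {24} {D} 6 (≤-trans lower (≤-reflexive (lemma D)))) ⟩
    D + 4       ≤⟨ upper ⟩
    e + 24      ≤⟨ +-monoˡ-≤ 24 (+-cancelʳ-≤ 8 e 2 e≤) ⟩
    26          ∎)
  where
  open ≤-Reasoning
  lemma : ∀ D → 2 * (3 * D) ≡ 6 * D
  lemma = solve-∀

exceptional-gap : ∀ {i n z r L} → Exceptional i n z r → L + r ≡ n → z + z < L × 0 < z
exceptional-gap {L = L} (refl , inj₁ (refl , refl , refl)) L≡ with refl ← +-cancelʳ-≡ 2 L 7 L≡ = ≤-refl , z<s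
exceptional-gap {L = L} (refl , inj₂ (refl , refl , refl)) L≡ with refl ← +-cancelʳ-≡ 2 L 10 L≡ = <ᵇ⇒< _ _ tt , z<s

order≥2k : ∀ i {n z r w} → (2 + i) * n ≤ 2 * (3 + i) * z → 2 ≤ r → r + z + w ≡ n → z ≤ w → 6 + 2 * i ≤ n
order≥2k i {n} {z} {r} {w} hz 2≤r n≡ z≤w = +-cancelˡ-≤ ((2 + i) * n) _ _ (begin
  (2 + i) * n + (6 + 2 * i)              ≤⟨ +-monoˡ-≤ _ hz ⟩
  2 * (3 + i) * z + (6 + 2 * i)          ≡⟨ lemma i z ⟩
  (3 + i) * (2 + z + z)                  ≤⟨ *-monoʳ-≤ (3 + i) (+-mono-≤ (+-monoˡ-≤ z 2≤r) z≤w) ⟩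
  (3 + i) * (r + z + w)                  ≡⟨ cong ((3 + i) *_) n≡ ⟩
  (3 + i) * n                            ≡⟨ +-comm n ((2 + i) * n) ⟩
  (2 + i) * n + n                        ∎)
  where
  open ≤-Reasoning
  lemma : ∀ i z → 2 * (3 + i) * z + (6 + 2 * i) ≡ (3 + i) * (2 + z + z)
  lemma = solve-∀

order≡2k : ∀ i {z r w} → (2 + i) * (6 + 2 * i) ≤ 2 * (3 + i) * z → 2 ≤ r → r + z + w ≡ 6 + 2 * i → z ≤ w →
           r + z ≡ 4 + i × w ≡ 2 + i
order≡2k i {z} {r} {w} hz 2≤r n≡ z≤w =
  squeeze {4 + i} {2 + i} (+-mono-≤ 2≤r z≥) (≤-trans z≥ z≤w) (≤-reflexive (trans n≡ (lemma′ i)))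
  where
  lemma : ∀ i → (2 + i) * (6 + 2 * i) ≡ 2 * (3 + i) * (2 + i)
  lemma = solve-∀
  lemma′ : ∀ i → 6 + 2 * i ≡ 4 + i + (2 + i)
  lemma′ = solve-∀
  z≥ : 2 + i ≤ z
  z≥ = *-cancelˡ-≤ (2 * (3 + i)) (≤-trans (≤-reflexive (≡-sym (lemma i))) hz)

module _ {n : ℕ} (G : Graph (Fin n)) where

  open import Data.List.Membership.DecPropositional (_≟ᶠ_ {n}) using (_∈?_)

  private
    V = Fin n
    variable
      a b c c′ d e e′ w x y : V
      X Y Z xs ys : List V

  data Seg : V → List V → V → Set where
    point : ∀ a → Seg a (a ∷ []) a
    _∷_   : Adj G a b → Seg b xs c → Seg a (a ∷ xs) c

  infixr 5 _⟨_⟩_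
  _⟨_⟩_ : Seg a xs b → Adj G b c → Seg c ys d → Seg a (xs ++ ys) d
  point a ⟨ p ⟩ t = p ∷ t
  (q ∷ s) ⟨ p ⟩ t = q ∷ (s ⟨ p ⟩ t)

  reverseSeg : Seg a xs b → Seg b (reverse xs) a
  reverseSeg (point a) = point a
  reverseSeg {a} {_ ∷ xs} (p ∷ s) =
    subst (λ l → Seg _ l a) (≡-sym (unfold-reverse a xs)) (reverseSeg s ⟨ sym G p ⟩ point a)

  head∈ : Seg a xs b → a ∈ xs
  head∈ (point _) = here refl
  head∈ (_ ∷ _)   = here refl

  last∈ : Seg a xs b → b ∈ xs
  last∈ (point _) = here refl
  last∈ (_ ∷ s)   = there (last∈ s)

  steps-first : Seg a xs b → a ∷ map proj₂ (steps xs) ≡ xs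
  steps-first (point _)             = refl
  steps-first {xs = _ ∷ xs} (_ ∷ _) = cong (_ ∷_) (steps-proj₂ _ xs)

  steps-∷ : Seg b ys c → steps (a ∷ ys) ≡ (a , b) ∷ steps ys
  steps-∷ (point _) = refl
  steps-∷ (_ ∷ _)   = refl

  steps-++ : Seg a xs b → Seg c ys d → steps (xs ++ ys) ≡ steps xs ++ (b , c) ∷ steps ys
  steps-++ (point _)           t = steps-∷ t
  steps-++ (_ ∷ s@(point _))   t = cong (_ ∷_) (steps-++ s t)
  steps-++ (_ ∷ s@(_ ∷ _))     t = cong (_ ∷_) (steps-++ s t)

  steps-last : Seg a xs b → map proj₁ (steps xs) ++ b ∷ [] ≡ xs
  steps-last (point _)         = refl
  steps-last (_ ∷ s@(point _)) = refl
  steps-last (_ ∷ s@(_ ∷ _))   = cong (_ ∷_) (steps-last s)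

  record Split (a : V) (xs : List V) (b e e′ : V) : Set where
    constructor split
    field
      {ls rs} : List V
      xs≡     : xs ≡ ls ++ rs
      before  : Seg a ls e
      edge    : Adj G e e′
      after   : Seg e′ rs b

  splitAt : Seg a xs b → (e , e′) ∈ steps xs → Split a xs b e e′
  splitAt (p ∷ s@(point _)) (here refl) = split refl (point _) p s
  splitAt (p ∷ s@(_ ∷ _))   (here refl) = split refl (point _) p s
  splitAt (p ∷ s@(_ ∷ _))   (there m) with splitAt s m
  ... | split eq t q r = split (cong (_ ∷_) eq) (p ∷ t) q r

  -- A single edge counts as a cycle on two vertices.
  record Cycle (Z : List V) : Set where
    field
      {first last} : V
      seg    : Seg first Z last
      close  : Adj G last first
      unique : Unique Z

    links : List (V × V)
    links = (last , first) ∷ steps Z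

    links-proj₂ : map proj₂ links ≡ Z
    links-proj₂ = steps-first seg

    links-proj₁ : map proj₁ links ↭ Z
    links-proj₁ = ↭-trans (↭ₚ.∷↭∷ʳ last (map proj₁ (steps Z))) (↭-reflexive (steps-last seg))

  module _ {Z : List V} (C : Cycle Z) where
    open Cycle C

    record Opened (e e′ : V) : Set where
      constructor opened
      field
        {zs}   : List V
        arc    : Seg e′ zs e
        zs↭Z   : zs ↭ Z
        steps⊆ : ∀ {l} → l ∈ steps zs → l ∈ links
        links⊆ : ∀ {l} → l ∈ links → l ≡ (e , e′) ⊎ l ∈ steps zs

    open-at : (e , e′) ∈ links → Opened e e′
    open-at (here refl) = opened seg ↭-refl there λ { (here p) → inj₁ p ; (there p) → inj₂ p }
    open-at {e} {e′} (there m) with splitAt seg m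
    ... | split {ys} {zs} eq s p t =
      opened (t ⟨ close ⟩ s)
             (↭-trans (↭ₚ.++-comm zs ys) (↭-reflexive (≡-sym eq))) to from
      where
      rotated : steps (zs ++ ys) ≡ steps zs ++ (last , first) ∷ steps ys
      rotated = steps-++ t s

      original : steps Z ≡ steps ys ++ (e , e′) ∷ steps zs
      original = trans (cong steps eq) (steps-++ s t)

      to : ∀ {l} → l ∈ steps (zs ++ ys) → l ∈ links
      to {l} q with ∈-++⁻ (steps zs) (subst (l ∈_) rotated q)
      ... | inj₁ q′          = there (subst (l ∈_) (≡-sym original) (∈-++⁺ʳ (steps ys) (there q′)))
      ... | inj₂ (here q′)   = here q′
      ... | inj₂ (there q′)  = there (subst (l ∈_) (≡-sym original) (∈-++⁺ˡ q′))

      from : ∀ {l} → l ∈ links → l ≡ (e , e′) ⊎ l ∈ steps (zs ++ ys)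
      from {l} (here q) = inj₂ (subst (l ∈_) (≡-sym rotated) (∈-++⁺ʳ (steps zs) (here q)))
      from {l} (there q) with ∈-++⁻ (steps ys) (subst (l ∈_) original q)
      ... | inj₁ q′         = inj₂ (subst (l ∈_) (≡-sym rotated) (∈-++⁺ʳ (steps zs) (there q′)))
      ... | inj₂ (here q′)  = inj₁ q′
      ... | inj₂ (there q′) = inj₂ (subst (l ∈_) (≡-sym rotated) (∈-++⁺ˡ q′))

    record Arcs (c c′ e e′ : V) : Set where
      constructor arcs
      field
        {ls rs} : List V
        arc₁    : Seg c′ ls e
        arc₂    : Seg e′ rs c
        ↭Z      : ls ++ rs ↭ Z

    two-arcs : (c , c′) ∈ links → (e , e′) ∈ links →
               (e , e′) ≡ (c , c′) ⊎ Arcs c c′ e e′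
    two-arcs m m′ with open-at m
    ... | opened s zs↭ _ links⊆ with links⊆ m′
    ...   | inj₁ eq  = inj₁ eq
    ...   | inj₂ m″ with splitAt s m″
    ...     | split eq t _ r = inj₂ (arcs t r (↭-trans (↭-reflexive (≡-sym eq)) zs↭))

    predecessor : ∀ {x} → x ∈ Z → ∃[ y ] (y , x) ∈ links
    predecessor {x} x∈ with ∈-map⁻ proj₂ (subst (x ∈_) (≡-sym links-proj₂) x∈)
    ... | (y , _) , m , refl = y , m

  Longest : ℕ → Set
  Longest m = ∀ {a xs b} → Seg a xs b → Unique xs → length xs ≤ m

  too-long : ∀ {m} → Longest m → Seg a xs b → xs ↭ ys → Unique ys → ¬ (m < length ys)
  too-long longest s p u m< = <⇒≱ m< (subst (_≤ _) (↭ₚ.↭-length p) (longest s (Unique-resp-↭ (↭-sym p) u)))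

  boundary-edge : ∀ Z → a ∈ Z → w ∉ Z → Star (Adj G) a w → ∃[ x ] ∃[ y ] (x ∈ Z × y ∉ Z × Adj G x y)
  boundary-edge Z a∈ w∉ ε = ⊥-elim (w∉ a∈)
  boundary-edge Z a∈ w∉ (_◅_ {j = b} p ps) with b ∈? Z
  ... | yes b∈ = boundary-edge Z b∈ w∉ ps
  ... | no  b∉ = _ , _ , a∈ , b∉ , p

  unique-∷ : w ∉ xs → Unique xs → Unique (w ∷ xs)
  unique-∷ w∉ u = ∉⇒All≢ w∉ ∷ u

  module _ (connected : Connected G) {m : ℕ} (longest : Longest m) where

    cycle-short : Cycle Z → w ∉ Z → length Z < m
    cycle-short {Z} {w} C w∉ with boundary-edge Z (head∈ (Cycle.seg C)) w∉ (proj₂ connected _ w)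
    ... | x , y , x∈ , y∉ , p with predecessor C x∈
    ...   | _ , l with open-at C l
    ...     | opened s zs↭ _ _ =
      ≮⇒≥ (too-long longest (sym G p ∷ s) (↭-prep y zs↭) (unique-∷ y∉ (Cycle.unique C)))

  adj : V → V → ℕ
  adj x y = ⟦ adj? G x y ⟧

  adj≤1 : ∀ x y → adj x y ≤ 1
  adj≤1 x y = ⟦⟧≤1 (adj? G x y)

  adj≡0 : ∀ {x y} → ¬ Adj G x y → adj x y ≡ 0
  adj≡0 {x} {y} = ⟦⟧≡0 (adj? G x y)

  adj-sym : ∀ x y → adj x y ≡ adj y x
  adj-sym x y = ⟦⟧-cong (adj? G x y) (adj? G y x) (sym G) (sym G)

  deg≡∑ : ∀ {xs} → Unique xs → ∀ x → deg G x ≡ ∑ (adj x) xs + ∑ (adj x) (others xs)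
  deg≡∑ {xs} u x = trans (length-filter≡∑ (adj? G x) (allFin n))
    (trans (∑-↭ (adj x) (allFin-↭ u)) (∑-++ (adj x) xs (others xs)))

  deg≡∑-inside : ∀ {xs} → Unique xs → ∀ {x} → (∀ {y} → Adj G x y → y ∈ xs) → deg G x ≡ ∑ (adj x) xs
  deg≡∑-inside {xs} u {x} N⊆ = trans (deg≡∑ u x)
    (trans (cong (∑ (adj x) xs +_) (∑-zero (others xs) (λ y∈ → adj≡0 (λ p → ∈-others⁻ y∈ (N⊆ p)))))
           (+-identityʳ _))

  module _ (connected : Connected G) {m : ℕ} (longest : Longest m)
           {p q : V} {P : List V} (path : Seg p P q) (unique : Unique P) (|P|≡m : length P ≡ m)
           {v : V} (v∉P : v ∉ P) where

    no-longer-path : ∀ {a xs b w} → Seg a xs b → w ∉ P → ¬ (xs ↭ w ∷ P)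
    no-longer-path s w∉ xs↭ =
      too-long longest s xs↭ (unique-∷ w∉ unique) (s≤s (≤-reflexive (≡-sym |P|≡m)))

    no-spanning-cycle : ∀ {xs} → Cycle xs → ¬ (xs ↭ P)
    no-spanning-cycle C xs↭ = <-irrefl (trans (↭ₚ.↭-length xs↭) |P|≡m)
      (cycle-short connected longest C (v∉P ∘ ↭ₚ.∈-resp-↭ xs↭))

    crossing-cycle : Seg p X c → Seg e Y q → Adj G q c → Adj G p e → Unique (X ++ Y) →
                     ∃[ Z ] (Cycle Z × Z ↭ X ++ Y)
    crossing-cycle {X = X} {Y = Y} s t qc pe u = X ++ reverse Y , C , XY↭
      where
      XY↭ : X ++ reverse Y ↭ X ++ Y
      XY↭ = ↭ₚ.++⁺ˡ X (↭ₚ.↭-reverse Y)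
      C : Cycle (X ++ reverse Y)
      C = record { seg = s ⟨ sym G qc ⟩ reverseSeg t ; close = sym G pe ; unique = Unique-resp-↭ (↭-sym XY↭) u }

    -- For consecutive vertices c, d of the path: A means p ~ d, B means q ~ c, C means v ~ c,
    -- and ⁺ refers to the next pair of consecutive vertices.
    ¬A∧B : Seg p X c → Seg d Y q → X ++ Y ↭ P → Adj G q c → ¬ Adj G p d
    ¬A∧B s t XY↭ qc pd with crossing-cycle s t qc pd (Unique-resp-↭ (↭-sym XY↭) unique)
    ... | _ , C , Z↭ = no-spanning-cycle C (↭-trans Z↭ XY↭)

    ¬A∧C : Seg p X c → Seg d Y q → X ++ Y ↭ P → Adj G v c → ¬ Adj G p d
    ¬A∧C {X = X} {Y = Y} s t XY↭ vc pd = no-longer-path (vc ∷ (reverseSeg s ⟨ pd ⟩ t)) v∉P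
      (↭-prep v (↭-trans (↭ₚ.++⁺ʳ Y (↭ₚ.↭-reverse X)) XY↭))

    ¬B∧C⁺ : Seg p X c → Seg d Y q → X ++ Y ↭ P → Adj G q c → ¬ Adj G v d
    ¬B∧C⁺ {X = X} {Y = Y} s t XY↭ qc vd = no-longer-path (vd ∷ (t ⟨ qc ⟩ reverseSeg s)) v∉P
      (↭-prep v (↭-trans (↭ₚ.++⁺ˡ Y (↭ₚ.↭-reverse X)) (↭-trans (↭ₚ.++-comm Y X) XY↭)))

    ShorterCycle : Set
    ShorterCycle = ∃[ Z ] (Cycle Z × suc (length Z) ≡ m)

    B∧A⁺ : Seg p X c → Seg e Y q → X ++ d ∷ Y ↭ P → Adj G q c → Adj G p e → ShorterCycle
    B∧A⁺ {X = X} {Y = Y} {d = d} s t XdY↭ qc pe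
      with crossing-cycle s t qc pe (AllPairs.tail (Unique-resp-↭ (↭-trans (↭-sym XdY↭) (↭ₚ.shift d X Y)) unique))
    ... | Z , C , Z↭ = Z , C , trans (↭ₚ.↭-length (↭-trans (↭-prep d Z↭) (↭-trans (↭-sym (↭ₚ.shift d X Y)) XdY↭))) |P|≡m

    weight : V × V → ℕ
    weight (x , y) = adj p y + (adj q x + adj v x)

    A+C≤1 : Seg p X c → Seg d Y q → X ++ Y ↭ P → adj p d + adj v c ≤ 1
    A+C≤1 {c = c} {d = d} s t XY↭ with adj? G p d
    ... | no _   = adj≤1 v c
    ... | yes pd = ≤-reflexive (cong suc (adj≡0 (λ vc → ¬A∧C s t XY↭ vc pd)))

    extend : X ++ d ∷ Y ↭ P → (X ++ d ∷ []) ++ Y ↭ P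
    extend {X = X} {d = d} {Y = Y} = ↭-trans (↭-reflexive (++-assoc X (d ∷ []) Y))

    -- The sum over the remaining links can exceed their number by one only if some later
    -- vertex starts a run of neighbours of q, hence not when c already lies in such a run.
    afterN : Seg p X c → Adj G c d → Seg d Y q → X ++ Y ↭ P →
             ShorterCycle ⊎ ∑ weight (steps Y) ≤ length Y
    afterB : Seg p X c → Adj G c d → Seg d Y q → X ++ Y ↭ P → Adj G q c →
             ShorterCycle ⊎ suc (∑ weight (steps Y)) ≤ length Y

    afterN s cd (point _) _ = inj₂ z≤n
    afterN {d = d} s cd (_∷_ {b = e} {xs = Y} de t) XY↭ rewrite steps-∷ {a = d} t
      with adj? G q d
    ... | yes qd = map₂ (λ h → ≤-trans (+-monoˡ-≤ _ weight≤2) (s≤s h))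
                        (afterB (s ⟨ cd ⟩ point d) de t (extend XY↭) qd)
      where
      weight≤2 : adj p e + (1 + adj v d) ≤ 2
      weight≤2 rewrite adj≡0 (¬A∧B (s ⟨ cd ⟩ point d) t (extend XY↭) qd) = s≤s (adj≤1 v d)
    ... | no ¬qd = map₂ (+-mono-≤ (A+C≤1 (s ⟨ cd ⟩ point d) t (extend XY↭)))
                        (afterN (s ⟨ cd ⟩ point d) de t (extend XY↭))

    afterB s cd (point _) _ _ = inj₂ ≤-refl
    afterB {d = d} s cd t₀@(_∷_ {b = e} {xs = Y} de t) XY↭ qc rewrite steps-∷ {a = d} t
      with adj? G p e
    ... | yes pe = inj₁ (B∧A⁺ s t XY↭ qc pe)
    ... | no _ rewrite adj≡0 (¬B∧C⁺ s t₀ XY↭ qc) with adj? G q d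
    ...   | yes qd = map₂ s≤s (afterB (s ⟨ cd ⟩ point d) de t (extend XY↭) qd)
    ...   | no  _  = map₂ s≤s (afterN (s ⟨ cd ⟩ point d) de t (extend XY↭))

    p≁q : ¬ Adj G p q
    p≁q pq = no-spanning-cycle (record { seg = path ; close = sym G pq ; unique = unique }) ↭-refl

    p≁v : ¬ Adj G p v
    p≁v pv = no-longer-path (sym G pv ∷ path) v∉P ↭-refl

    q≁v : ¬ Adj G q v
    q≁v qv = no-longer-path (sym G qv ∷ reverseSeg path) v∉P (↭-prep v (↭ₚ.↭-reverse P))

    N[p]⊆P : ∀ {y} → Adj G p y → y ∈ P
    N[p]⊆P {y} py with y ∈? P
    ... | yes y∈ = y∈
    ... | no  y∉ = ⊥-elim (no-longer-path (sym G py ∷ path) y∉ ↭-refl)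

    N[q]⊆P : ∀ {y} → Adj G q y → y ∈ P
    N[q]⊆P {y} qy with y ∈? P
    ... | yes y∈ = y∈
    ... | no  y∉ = ⊥-elim (no-longer-path (sym G qy ∷ reverseSeg path) y∉ (↭-prep y (↭ₚ.↭-reverse P)))

    ∑-weight : ∑ weight (steps P) ≡ deg G p + (deg G q + ∑ (adj v) P)
    ∑-weight = begin
      ∑ weight (steps P)
        ≡⟨ ∑-+ _ _ (steps P) ⟩
      ∑ (adj p ∘ proj₂) (steps P) + ∑ (λ l → adj q (proj₁ l) + adj v (proj₁ l)) (steps P)
        ≡⟨ cong₂ _+_ (∑-map (adj p) proj₂ (steps P)) (∑-+ _ _ (steps P)) ⟩
      ∑ (adj p) (map proj₂ (steps P)) + (∑ (adj q ∘ proj₁) (steps P) + ∑ (adj v ∘ proj₁) (steps P))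
        ≡⟨ cong₂ _+_ tail≡ (cong₂ _+_ (init≡ q (irrefl G)) (init≡ v (q≁v ∘ sym G))) ⟩
      ∑ (adj p) P + (∑ (adj q) P + ∑ (adj v) P)
        ≡⟨ cong₂ (λ x y → x + (y + ∑ (adj v) P)) (deg≡∑-inside unique N[p]⊆P) (deg≡∑-inside unique N[q]⊆P) ⟨
      deg G p + (deg G q + ∑ (adj v) P) ∎
      where
      open ≡-Reasoning
      tail≡ : ∑ (adj p) (map proj₂ (steps P)) ≡ ∑ (adj p) P
      tail≡ = begin
        ∑ (adj p) (map proj₂ (steps P))           ≡⟨ cong (_+ ∑ (adj p) (map proj₂ (steps P))) (adj≡0 (irrefl G)) ⟨
        ∑ (adj p) (p ∷ map proj₂ (steps P))       ≡⟨ cong (∑ (adj p)) (steps-first path) ⟩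
        ∑ (adj p) P                               ∎
      init≡ : ∀ x → ¬ Adj G x q → ∑ (adj x ∘ proj₁) (steps P) ≡ ∑ (adj x) P
      init≡ x x≁q = begin
        ∑ (adj x ∘ proj₁) (steps P)                       ≡⟨ ∑-map (adj x) proj₁ (steps P) ⟩
        ∑ (adj x) (map proj₁ (steps P))                   ≡⟨ +-identityʳ _ ⟨
        ∑ (adj x) (map proj₁ (steps P)) + 0               ≡⟨ cong (λ k → ∑ (adj x) (map proj₁ (steps P)) + (k + 0)) (adj≡0 x≁q) ⟨
        ∑ (adj x) (map proj₁ (steps P)) + (adj x q + 0)   ≡⟨ ∑-++ (adj x) (map proj₁ (steps P)) (q ∷ []) ⟨
        ∑ (adj x) (map proj₁ (steps P) ++ q ∷ [])         ≡⟨ cong (∑ (adj x)) (steps-last path) ⟩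
        ∑ (adj x) P                                       ∎

    nontrivial : p ≢ q × (ShorterCycle ⊎ ∑ weight (steps P) ≤ length P)
    nontrivial = go path refl
      where
      go : ∀ {xs} → Seg p xs q → xs ≡ P → p ≢ q × (ShorterCycle ⊎ ∑ weight (steps xs) ≤ length xs)
      go (point _) refl with boundary-edge P (here refl) v∉P (proj₂ connected p v)
      ... | _ , _ , here refl , y∉ , py = ⊥-elim (y∉ (N[p]⊆P py))
      go (_∷_ {xs = Y} pe t) refl = (λ { refl → Uniqueₚ.Unique[x∷xs]⇒x∉xs unique (last∈ t) }) , bound
        where
        bound : ShorterCycle ⊎ ∑ weight (steps (p ∷ Y)) ≤ suc (length Y)
        bound rewrite steps-∷ {a = p} t | adj≡0 (p≁q ∘ sym G) | adj≡0 (p≁v ∘ sym G) =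
          map₂ (+-mono-≤ (≤-trans (≤-reflexive (+-identityʳ _)) (adj≤1 p _))) (afterN (point p) pe t ↭-refl)

    few-degrees : ∑ weight (steps P) ≤ length P → deg G p + (deg G q + deg G v) < n
    few-degrees h = begin-strict
      deg G p + (deg G q + deg G v)                                           <⟨ n<1+n _ ⟩
      suc (deg G p + (deg G q + deg G v))                                     ≡⟨ cong (λ x → suc (deg G p + (deg G q + x))) (deg≡∑ unique v) ⟩
      suc (deg G p + (deg G q + (∑ (adj v) P + ∑ (adj v) (others P))))        ≡⟨ lemma (deg G p) (deg G q) _ _ ⟩
      deg G p + (deg G q + ∑ (adj v) P) + (∑ (adj v) (others P) + 1)          ≤⟨ +-mono-≤ (≤-trans (≤-reflexive (≡-sym ∑-weight)) h) off ⟩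
      length P + length (others P)                                            ≡⟨ length-others unique ⟩
      n                                                                       ∎
      where
      open ≤-Reasoning
      lemma : ∀ a b c d → suc (a + (b + (c + d))) ≡ a + (b + c) + (d + 1)
      lemma = solve-∀
      off : ∑ (adj v) (others P) + 1 ≤ length (others P)
      off = subst (∑ (adj v) (others P) + 1 ≤_)
        (cong₂ _+_ (adj≡0 (irrefl G {v})) (*-identityʳ (length (others P))))
        (∑-bound-at (others P) (λ {y} _ → adj≤1 v y) (∈-others⁺ v∉P))

    shorter-cycle : (∀ {x y z} → x ≢ y → x ≢ z → y ≢ z → ¬ Adj G x y → ¬ Adj G x z → ¬ Adj G y z →
                     n ≤ deg G x + (deg G y + deg G z)) → ShorterCycle
    shorter-cycle σ₃ with nontrivial
    ... | _   , inj₁ C = C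
    ... | p≢q , inj₂ h = ⊥-elim (<⇒≱ (few-degrees h)
      (σ₃ p≢q (λ { refl → v∉P (head∈ path) }) (λ { refl → v∉P (last∈ path) }) p≁q p≁v q≁v))

  path? : Decidable (IsPath G)
  path? xs = Linked.linked? (adj? G) xs ×-dec unique? _≟ᶠ_ xs

  Seg⇒Linked : ∀ {a xs b} → Seg a xs b → Linked (Adj G) xs
  Seg⇒Linked (point _)         = [-]
  Seg⇒Linked (p ∷ s@(point _)) = p ∷ Seg⇒Linked s
  Seg⇒Linked (p ∷ s@(_ ∷ _))   = p ∷ Seg⇒Linked s

  Linked⇒Seg : ∀ {x xs} → Linked (Adj G) (x ∷ xs) → ∃[ b ] Seg x (x ∷ xs) b
  Linked⇒Seg [-]     = _ , point _
  Linked⇒Seg (p ∷ l) = _ , p ∷ proj₂ (Linked⇒Seg l)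

  record LongestPath : Set where
    field
      {first last} : Fin n
      {vertices}   : List (Fin n)
      seg          : Seg first vertices last
      unique       : Unique vertices
      longest      : Longest (length vertices)

  longest-path : Fin n → LongestPath
  longest-path v = search n (λ {_} {xs} _ u → subst (length xs ≤_) (length-others u) (m≤m+n (length xs) _))
    where
    search : ∀ j → Longest j → LongestPath
    search zero    l = ⊥-elim (<⇒≱ z<s (l (point v) ([] ∷ [])))
    search (suc j) l with listOfLength? path? (suc j)
    ... | yes (x ∷ xs , eq , linked , u) = record
      { seg = proj₂ (Linked⇒Seg linked) ; unique = u ; longest = subst Longest (≡-sym eq) l }
    ... | no ∄ = search j (λ s u → s≤s⁻¹ (≤∧≢⇒< (l s u) (λ eq → ∄ (_ , eq , Seg⇒Linked s , u))))

  missed-vertex : ¬ HasHamiltonianPath G → ∀ {a xs b} → Seg a xs b → Unique xs → ∃[ v ] v ∉ xs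
  missed-vertex ¬ham {xs = xs} s u = ¬∀⟶∃¬ n _ (_∈? xs) (λ all∈ → ¬ham (xs , (Seg⇒Linked s , u) , all∈))

  module OffCycle (connected : Connected G) {Z : List V} (C : Cycle Z) (longest : Longest (suc (length Z)))
           {u₁ u₂ : V} (u₁∉ : u₁ ∉ Z) (u₂∉ : u₂ ∉ Z) (u₁≢u₂ : u₁ ≢ u₂) where
    open Cycle C

    no-path : ∀ {a b xs} → x ∉ Z → y ∉ Z → x ≢ y → Seg a xs b → ¬ (xs ↭ x ∷ y ∷ Z)
    no-path x∉ y∉ x≢y s xs↭ = too-long longest s xs↭
      ((x≢y ∷ ∉⇒All≢ x∉) ∷ unique-∷ y∉ unique) ≤-refl

    no-cycle : x ∉ Z → ∀ {a b xs} → Seg a xs b → Adj G b a → ¬ (xs ↭ x ∷ Z)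
    no-cycle {x} x∉ s p xs↭ = <-irrefl (↭ₚ.↭-length xs↭) (cycle-short connected longest
      (record { seg = s ; close = p ; unique = Unique-resp-↭ (↭-sym xs↭) (unique-∷ x∉ unique) })
      (outside ∘ ↭ₚ.∈-resp-↭ xs↭))
      where
      another : ∃[ y ] (y ∉ Z × y ≢ x)
      another with u₁ ≟ᶠ x
      ... | no u₁≢x  = u₁ , u₁∉ , u₁≢x
      ... | yes refl = u₂ , u₂∉ , u₁≢u₂ ∘ ≡-sym
      outside : proj₁ another ∉ x ∷ Z
      outside (here eq)  = proj₂ (proj₂ another) eq
      outside (there y∈) = proj₁ (proj₂ another) y∈

    off-independent : x ∉ Z → y ∉ Z → ¬ Adj G x y
    off-independent x∉ y∉ xy = go (proj₂ connected _ first) x∉ y∉ (sym G xy)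
      where
      go : Star (Adj G) x first → x ∉ Z → y ∉ Z → ¬ Adj G y x
      go ε x∉ _ _ = x∉ (head∈ seg)
      go (_◅_ {j = w} xw ws) x∉ y∉ yx with w ∈? Z
      ... | no w∉  = go ws w∉ x∉ xw
      ... | yes w∈ with predecessor C w∈
      ...   | _ , l with open-at C l
      ...     | opened s zs↭ _ _ = no-path y∉ x∉ (λ { refl → irrefl G yx })
                (yx ∷ xw ∷ s) (↭-prep _ (↭-prep _ zs↭))

    off-nbr∈Z : x ∉ Z → Adj G x y → y ∈ Z
    off-nbr∈Z {y = y} x∉ xy = decidable-stable (y ∈? Z) (λ y∉ → off-independent x∉ y∉ xy)

    no-consecutive : (c , c′) ∈ links → x ∉ Z → y ∉ Z → Adj G x c → ¬ Adj G y c′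
    no-consecutive {x = x} {y} l x∉ y∉ xc yc′ with open-at C l | x ≟ᶠ y
    ... | opened s zs↭ _ _ | yes refl = no-cycle x∉ (yc′ ∷ s) (sym G xc) (↭-prep x zs↭)
    ... | opened s zs↭ _ _ | no x≢y   = no-path y∉ x∉ (x≢y ∘ ≡-sym) (yc′ ∷ (s ⟨ sym G xc ⟩ point x))
      (↭-prep y (↭-trans (↭-sym (↭ₚ.∷↭∷ʳ x _)) (↭-prep x zs↭)))

    module At {v : V} (v∉ : v ∉ Z) where

      N N⁺ N⁻ : List V
      N  = filter (adj? G v) Z
      N⁺ = map proj₂ (filter (adj? G v ∘ proj₁) links)
      N⁻ = map proj₁ (filter (adj? G v ∘ proj₂) links)

      ∈-N⁺⁻ : c′ ∈ N⁺ → ∃[ c ] ((c , c′) ∈ links × Adj G v c)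
      ∈-N⁺⁻ c′∈ with ∈-map⁻ proj₂ c′∈
      ... | (c , _) , l , refl = c , ∈-filter⁻ (adj? G v ∘ proj₁) {xs = links} l

      ∈-N⁻⁻ : c ∈ N⁻ → ∃[ c′ ] ((c , c′) ∈ links × Adj G v c′)
      ∈-N⁻⁻ c∈ with ∈-map⁻ proj₁ c∈
      ... | (_ , c′) , l , refl = c′ , ∈-filter⁻ (adj? G v ∘ proj₂) {xs = links} l

      ∈-N⁻⁺ : (c , c′) ∈ links → Adj G v c′ → c ∈ N⁻
      ∈-N⁻⁺ l vc = ∈-map⁺ proj₁ (∈-filter⁺ (adj? G v ∘ proj₂) l vc)

      snd∈Z : (c , c′) ∈ links → c′ ∈ Z
      snd∈Z {c′ = c′} l = subst (c′ ∈_) links-proj₂ (∈-map⁺ proj₂ l)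

      fst∈Z : (c , c′) ∈ links → c ∈ Z
      fst∈Z l = ↭ₚ.∈-resp-↭ links-proj₁ (∈-map⁺ proj₁ l)

      N⁺⊆Z : x ∈ N⁺ → x ∈ Z
      N⁺⊆Z = snd∈Z ∘ proj₁ ∘ proj₂ ∘ ∈-N⁺⁻

      N⁻⊆Z : x ∈ N⁻ → x ∈ Z
      N⁻⊆Z = fst∈Z ∘ proj₁ ∘ proj₂ ∘ ∈-N⁻⁻

      unique-proj₂ : Unique (map proj₂ links)
      unique-proj₂ = subst Unique (≡-sym links-proj₂) unique

      N⁺-unique : Unique N⁺
      N⁺-unique = unique-map-filter proj₂ (adj? G v ∘ proj₁) {links} unique-proj₂

      N⁻-unique : Unique N⁻
      N⁻-unique = unique-map-filter proj₁ (adj? G v ∘ proj₂) {links} (Unique-resp-↭ (↭-sym links-proj₁) unique)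

      |N|≡deg : length N ≡ deg G v
      |N|≡deg = trans (length-filter≡∑ (adj? G v) Z) (≡-sym (deg≡∑-inside unique (off-nbr∈Z v∉)))

      |N⁺|≡deg : length N⁺ ≡ deg G v
      |N⁺|≡deg = begin
        length N⁺                                      ≡⟨ length-map proj₂ (filter (adj? G v ∘ proj₁) links) ⟩
        length (filter (adj? G v ∘ proj₁) links)       ≡⟨ length-filter≡∑ (adj? G v ∘ proj₁) links ⟩
        ∑ (adj v ∘ proj₁) links                        ≡⟨ ∑-map (adj v) proj₁ links ⟩
        ∑ (adj v) (map proj₁ links)                    ≡⟨ ∑-↭ (adj v) links-proj₁ ⟩
        ∑ (adj v) Z                                    ≡⟨ deg≡∑-inside unique (off-nbr∈Z v∉) ⟨
        deg G v                                        ∎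
        where open ≡-Reasoning

      |N⁻|≡deg : length N⁻ ≡ deg G v
      |N⁻|≡deg = begin
        length N⁻                                      ≡⟨ length-map proj₁ (filter (adj? G v ∘ proj₂) links) ⟩
        length (filter (adj? G v ∘ proj₂) links)       ≡⟨ length-filter≡∑ (adj? G v ∘ proj₂) links ⟩
        ∑ (adj v ∘ proj₂) links                        ≡⟨ ∑-map (adj v) proj₂ links ⟩
        ∑ (adj v) (map proj₂ links)                    ≡⟨ cong (∑ (adj v)) links-proj₂ ⟩
        ∑ (adj v) Z                                    ≡⟨ deg≡∑-inside unique (off-nbr∈Z v∉) ⟨
        deg G v                                        ∎
        where open ≡-Reasoning

      N⁺-independent : x ∈ N⁺ → y ∈ N⁺ → ¬ Adj G x y
      N⁺-independent x∈ y∈ xy with ∈-N⁺⁻ x∈ | ∈-N⁺⁻ y∈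
      ... | c , l , vc | e , l′ , ve with two-arcs C l l′
      ...   | inj₁ refl = irrefl G xy
      ...   | inj₂ (arcs {ls} {rs} s t ↭Z) = no-cycle v∉ (ve ∷ (reverseSeg s ⟨ xy ⟩ t)) (sym G vc)
              (↭-prep v (↭-trans (↭ₚ.++⁺ʳ rs (↭ₚ.↭-reverse ls)) ↭Z))

      N⁻-independent : x ∈ N⁻ → y ∈ N⁻ → ¬ Adj G x y
      N⁻-independent x∈ y∈ xy with ∈-N⁻⁻ x∈ | ∈-N⁻⁻ y∈
      ... | c′ , l , vc′ | e′ , l′ , ve′ with two-arcs C l l′
      ...   | inj₁ refl = irrefl G xy
      ...   | inj₂ (arcs {ls} {rs} s t ↭Z) = no-cycle v∉ (vc′ ∷ (s ⟨ sym G xy ⟩ reverseSeg t)) (sym G ve′)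
              (↭-prep v (↭-trans (↭ₚ.++⁺ˡ ls (↭ₚ.↭-reverse rs)) ↭Z))

      I W : List V
      I = others Z ++ N⁺
      W = others I

      I-unique : Unique I
      I-unique = Uniqueₚ.++⁺ (others-unique Z) N⁺-unique (λ (p , q) → ∈-others⁻ p (N⁺⊆Z q))

      |I| : length I ≡ length (others Z) + deg G v
      |I| = trans (length-++ (others Z)) (cong (length (others Z) +_) |N⁺|≡deg)

      off≁N⁺ : x ∉ Z → y ∈ N⁺ → ¬ Adj G x y
      off≁N⁺ x∉ y∈ with ∈-N⁺⁻ y∈
      ... | _ , l , vc = no-consecutive l v∉ x∉ vc

      off≁N⁻ : x ∉ Z → y ∈ N⁻ → ¬ Adj G x y
      off≁N⁻ x∉ y∈ xy with ∈-N⁻⁻ y∈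
      ... | _ , l , vc = no-consecutive l x∉ v∉ xy vc

      I-independent : x ∈ I → y ∈ I → ¬ Adj G x y
      I-independent x∈ y∈ xy with ∈-++⁻ (others Z) x∈ | ∈-++⁻ (others Z) y∈
      ... | inj₁ p | inj₁ q = off-independent (∈-others⁻ p) (∈-others⁻ q) xy
      ... | inj₁ p | inj₂ q = off≁N⁺ (∈-others⁻ p) q xy
      ... | inj₂ p | inj₁ q = off≁N⁺ (∈-others⁻ q) p (sym G xy)
      ... | inj₂ p | inj₂ q = N⁺-independent p q xy

      module _ (2N<Z : deg G v + deg G v < length Z) (N≢∅ : 0 < deg G v) where

        Rest : V → Set
        Rest x = ¬ Adj G v x × x ∉ N⁺

        rest? : Decidable Rest
        rest? x = ¬? (adj? G v x) ×-dec ¬? (x ∈? N⁺)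

        some-rest : ∃[ x ] (x ∈ Z × Rest x)
        some-rest with any? rest? Z
        ... | yes r = find r
        ... | no ∄  = ⊥-elim (<⇒≱ 2N<Z (begin
          length Z              ≤⟨ length-⊆ unique covered ⟩
          length (N ++ N⁺)      ≡⟨ length-++ N ⟩
          length N + length N⁺  ≡⟨ cong₂ _+_ |N|≡deg |N⁺|≡deg ⟩
          deg G v + deg G v     ∎))
          where
          open ≤-Reasoning
          covered : ∀ {x} → x ∈ Z → x ∈ N ++ N⁺
          covered {x} x∈ with adj? G v x | x ∈? N⁺
          ... | yes vx | _     = ∈-++⁺ˡ (∈-filter⁺ (adj? G v) x∈ vx)
          ... | no _   | yes p = ∈-++⁺ʳ N p
          ... | no ¬vx | no ¬p = ⊥-elim (∄ (lose x∈ (¬vx , ¬p)))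

        spread : ∀ {P : V → Set} {a b xs} → Seg a xs b →
                 (∀ {e e′} → (e , e′) ∈ steps xs → P e → P e′) → P a → ∀ {x} → x ∈ xs → P x
        spread (point _) _ pa (here refl) = pa
        spread (_ ∷ _)   _ pa (here refl) = pa
        spread {xs = a ∷ xs} (_ ∷ s) h pa (there x∈) = spread s
          (λ m → h (subst (_ ∈_) (≡-sym (steps-∷ s)) (there m)))
          (h (subst (_ ∈_) (≡-sym (steps-∷ s)) (here refl)) pa) x∈

        -- Walking along the cycle from a vertex of Rest, the first neighbour of v is entered from Rest.
        gap-end : ∃[ b ] (b ∈ N⁻ × b ∉ N⁺)
        gap-end with any? (λ (b , c) → adj? G v c ×-dec ¬? (b ∈? N⁺)) links
        ... | yes a with find a
        ...   | (b , c) , l , vc , b∉ = b , ∈-N⁻⁺ l vc , b∉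
        gap-end | no ∄ with some-rest
        ... | x , x∈ , rx with predecessor C x∈
        ...   | _ , l with open-at C l
        ...     | opened s zs↭ steps⊆ _ = ⊥-elim (<-irrefl (≡-sym deg≡0) N≢∅)
          where
          closed : (c , c′) ∈ links → Rest c → Rest c′
          closed {c} {c′} l (¬vc , c∉) = (λ vc′ → ∄ (lose l (vc′ , c∉))) , λ c′∈ → step (∈-N⁺⁻ c′∈)
            where
            step : ¬ (∃[ d ] ((d , c′) ∈ links × Adj G v d))
            step (d , l′ , vd) with unique-map-injective proj₂ unique-proj₂ l l′ refl
            ... | refl = ¬vc vd
          all-rest : ∀ {y} → y ∈ Z → Rest y
          all-rest y∈ = spread s (λ m → closed (steps⊆ m)) rx (↭ₚ.∈-resp-↭ (↭-sym zs↭) y∈)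
          deg≡0 : deg G v ≡ 0
          deg≡0 = trans (deg≡∑-inside unique (off-nbr∈Z v∉)) (∑-zero Z (λ y∈ → adj≡0 (proj₁ (all-rest y∈))))

        sparse-vertex : ∃[ w ] (w ∈ W × ∑ (adj w) I + (deg G v + deg G v) ≤ length Z)
        sparse-vertex with gap-end
        ... | b , b∈ , b∉ = b , ∈-others⁺ b∉I , (begin
          ∑ (adj b) I + (deg G v + deg G v)                 ≡⟨ cong₂ (λ x y → x + (y + deg G v)) nbrs |N⁻|≡deg ⟨
          length T + (length N⁻ + deg G v)                  ≡⟨ cong (λ x → length T + (length N⁻ + x)) |N|≡deg ⟨
          length T + (length N⁻ + length N)                 ≡⟨ cong (length T +_) (length-++ N⁻) ⟨
          length T + length (N⁻ ++ N)                       ≡⟨ length-++ T ⟨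
          length (T ++ N⁻ ++ N)                             ≤⟨ length-⊆ T-unique T⊆Z ⟩
          length Z                                          ∎)
          where
          open ≤-Reasoning
          b∉I : b ∉ I
          b∉I p with ∈-++⁻ (others Z) p
          ... | inj₁ q = ∈-others⁻ q (N⁻⊆Z b∈)
          ... | inj₂ q = b∉ q
          T : List V
          T = filter (adj? G b) N⁺
          T⁻ : ∀ {x} → x ∈ T → x ∈ N⁺ × Adj G b x
          T⁻ = ∈-filter⁻ (adj? G b) {xs = N⁺}
          N⁻¹ : ∀ {x} → x ∈ N → x ∈ Z × Adj G v x
          N⁻¹ = ∈-filter⁻ (adj? G v) {xs = Z}
          nbrs : length T ≡ ∑ (adj b) I
          nbrs = ≡-sym (trans (∑-++ (adj b) (others Z) N⁺) (cong₂ _+_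
            (∑-zero (others Z) (λ u∈ → adj≡0 (λ bu → off≁N⁻ (∈-others⁻ u∈) b∈ (sym G bu))))
            (≡-sym (length-filter≡∑ (adj? G b) N⁺))))
          T-unique : Unique (T ++ N⁻ ++ N)
          T-unique = Uniqueₚ.++⁺ (Uniqueₚ.filter⁺ (adj? G b) N⁺-unique)
            (Uniqueₚ.++⁺ N⁻-unique (Uniqueₚ.filter⁺ (adj? G v) unique)
              (λ (p , q) → off≁N⁻ v∉ p (proj₂ (N⁻¹ q))))
            disjoint
            where
            disjoint : ∀ {x} → ¬ (x ∈ T × x ∈ N⁻ ++ N)
            disjoint (p , q) with ∈-++⁻ N⁻ q
            ... | inj₁ q′ = N⁻-independent b∈ q′ (proj₂ (T⁻ p))
            ... | inj₂ q′ = off≁N⁺ v∉ (proj₁ (T⁻ p)) (proj₂ (N⁻¹ q′))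
          T⊆Z : ∀ {x} → x ∈ T ++ N⁻ ++ N → x ∈ Z
          T⊆Z p with ∈-++⁻ T p
          ... | inj₁ q = N⁺⊆Z (proj₁ (T⁻ q))
          ... | inj₂ q with ∈-++⁻ N⁻ q
          ...   | inj₁ q′ = N⁻⊆Z q′
          ...   | inj₂ q′ = proj₁ (N⁻¹ q′)

  embedding⇒induced : ∀ {A : Set} (H : Graph A) (f : A → Fin n) → (∀ {x y} → f x ≡ f y → x ≡ y) →
    (∀ v → Dec (∃[ x ] f x ≡ v)) → (∀ x y → Adj G (f x) (f y) ⇔ Adj H x y) → HasInducedSubgraph G H
  embedding⇒induced {A} H f f-injective preimage? adj⇔ = S , record
    { bijection = mk↔ₛ′ to from to∘from from∘to
    ; adj⇔adj   = λ u v → mk⇔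
        (λ p → Equivalence.to (adj⇔ (to u) (to v)) (subst₂ (Adj G) (≡-sym (f∘to u)) (≡-sym (f∘to v)) p))
        (λ p → subst₂ (Adj G) (f∘to u) (f∘to v) (Equivalence.from (adj⇔ (to u) (to v)) p))
    }
    where
    S : Subset.Subset n
    S = tabulate (does ∘ preimage?)
    preimage : ∀ {v} → v Subset.∈ S → ∃[ x ] f x ≡ v
    preimage {v} v∈ = does-true (preimage? v) (trans (≡-sym (lookup∘tabulate _ v)) ([]=⇒lookup v∈))
    to : Σ[ v ∈ Fin n ] v Subset.∈ S → A
    to (v , v∈) = proj₁ (preimage v∈)
    f∘to : ∀ u → f (to u) ≡ proj₁ u
    f∘to (v , v∈) = proj₂ (preimage v∈)
    from : A → Σ[ v ∈ Fin n ] v Subset.∈ S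
    from x = f x , lookup⇒[]= (f x) S (trans (lookup∘tabulate _ (f x)) (dec-true (preimage? (f x)) (x , refl)))
    to∘from : ∀ x → to (from x) ≡ x
    to∘from x = f-injective (f∘to (from x))
    from∘to : ∀ u → from (to u) ≡ u
    from∘to u = Σ-≡ (f∘to u)
      where
      Σ-≡ : ∀ {u w : Σ[ v ∈ Fin n ] v Subset.∈ S} → proj₁ u ≡ proj₁ w → u ≡ w
      Σ-≡ {_ , p} {_ , q} refl = cong (_ ,_) ([]=-irrelevant p q)

  star⇒induced : ∀ {c leaves} → Unique leaves → (∀ {x} → x ∈ leaves → Adj G c x) →
    (∀ {x y} → x ∈ leaves → y ∈ leaves → ¬ Adj G x y) → HasInducedSubgraph G (K₁, length leaves)
  star⇒induced {c} {leaves} u c~ indep = embedding⇒induced (K₁, length leaves) f f-injective preimage? adj⇔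
    where
    f : ⊤ ⊎ Fin (length leaves) → Fin n
    f (inj₁ _) = c
    f (inj₂ i) = lookup leaves i
    c≢ : ∀ i → c ≢ lookup leaves i
    c≢ i eq = irrefl G (subst (Adj G c) (≡-sym eq) (c~ (∈-lookup i)))
    f-injective : ∀ {x y} → f x ≡ f y → x ≡ y
    f-injective {inj₁ _} {inj₁ _} _  = refl
    f-injective {inj₁ _} {inj₂ i} eq = ⊥-elim (c≢ i eq)
    f-injective {inj₂ i} {inj₁ _} eq = ⊥-elim (c≢ i (≡-sym eq))
    f-injective {inj₂ i} {inj₂ j} eq = cong inj₂ (lookup-injective u eq)
    preimage? : ∀ v → Dec (∃[ x ] f x ≡ v)
    preimage? v with c ≟ᶠ v
    ... | yes eq = yes (inj₁ tt , eq)
    ... | no c≢v = map′ (λ (i , eq) → inj₂ i , eq)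
      (λ { (inj₁ _ , eq) → ⊥-elim (c≢v eq) ; (inj₂ i , eq) → i , eq })
      (anyFin? (λ i → lookup leaves i ≟ᶠ v))
    adj⇔ : ∀ x y → Adj G (f x) (f y) ⇔ Adj (K₁, length leaves) x y
    adj⇔ (inj₁ _) (inj₁ _) = mk⇔ (irrefl G) (λ ())
    adj⇔ (inj₁ _) (inj₂ i) = mk⇔ (λ _ → tt) (λ _ → c~ (∈-lookup i))
    adj⇔ (inj₂ i) (inj₁ _) = mk⇔ (λ _ → tt) (λ _ → sym G (c~ (∈-lookup i)))
    adj⇔ (inj₂ i) (inj₂ j) = mk⇔ (indep (∈-lookup i) (∈-lookup j)) (λ ())

  join-decomposition : ∀ {I} → Unique I → (∀ {x y} → x ∈ I → y ∈ I → ¬ Adj G x y) →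
    (∀ {x y} → x ∈ I → y ∈ others I → Adj G x y) →
    Σ[ H ∈ Graph (Fin (length (others I))) ] (G ≅ H ∨ edgeless (Fin (length I)))
  join-decomposition {I} u indep complete = H , record
    { bijection = mk↔ₛ′ to f (λ x → f-injective (f∘to (f x))) f∘to
    ; adj⇔adj   = λ x y → mk⇔
        (λ p → Equivalence.to (adj⇔ (to x) (to y)) (subst₂ (Adj G) (≡-sym (f∘to x)) (≡-sym (f∘to y)) p))
        (λ p → subst₂ (Adj G) (f∘to x) (f∘to y) (Equivalence.from (adj⇔ (to x) (to y)) p))
    }
    where
    W : List (Fin n)
    W = others I
    H : Graph (Fin (length W))
    H = record
      { Adj    = λ i j → Adj G (lookup W i) (lookup W j)
      ; adj?   = λ i j → adj? G (lookup W i) (lookup W j)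
      ; sym    = sym G
      ; irrefl = irrefl G
      }
    f : Fin (length W) ⊎ Fin (length I) → Fin n
    f (inj₁ i) = lookup W i
    f (inj₂ i) = lookup I i
    W≢I : ∀ i j → lookup W i ≢ lookup I j
    W≢I i j eq = ∈-others⁻ (∈-lookup i) (subst (_∈ I) (≡-sym eq) (∈-lookup j))
    f-injective : ∀ {x y} → f x ≡ f y → x ≡ y
    f-injective {inj₁ i} {inj₁ j} eq = cong inj₁ (lookup-injective (others-unique I) eq)
    f-injective {inj₁ i} {inj₂ j} eq = ⊥-elim (W≢I i j eq)
    f-injective {inj₂ i} {inj₁ j} eq = ⊥-elim (W≢I j i (≡-sym eq))
    f-injective {inj₂ i} {inj₂ j} eq = cong inj₂ (lookup-injective u eq)
    to : Fin n → Fin (length W) ⊎ Fin (length I)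
    to x with x ∈? I
    ... | yes p = inj₂ (index p)
    ... | no ¬p = inj₁ (index (∈-others⁺ ¬p))
    f∘to : ∀ x → f (to x) ≡ x
    f∘to x with x ∈? I
    ... | yes p = ≡-sym (lookup-index p)
    ... | no ¬p = ≡-sym (lookup-index (∈-others⁺ ¬p))
    adj⇔ : ∀ x y → Adj G (f x) (f y) ⇔ Adj (H ∨ edgeless (Fin (length I))) x y
    adj⇔ (inj₁ _) (inj₁ _) = mk⇔ (λ p → p) (λ p → p)
    adj⇔ (inj₁ i) (inj₂ j) = mk⇔ (λ _ → tt) (λ _ → sym G (complete (∈-lookup j) (∈-lookup i)))
    adj⇔ (inj₂ i) (inj₁ j) = mk⇔ (λ _ → tt) (λ _ → complete (∈-lookup i) (∈-lookup j))
    adj⇔ (inj₂ i) (inj₂ j) = mk⇔ (indep (∈-lookup i) (∈-lookup j)) (λ ())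

  module _ {I : List V} (I-unique : Unique I) (I-independent : ∀ {x y} → x ∈ I → y ∈ I → ¬ Adj G x y) where

    deg≡∑-outside : x ∈ I → deg G x ≡ ∑ (adj x) (others I)
    deg≡∑-outside {x} x∈ = trans (deg≡∑ I-unique x)
      (cong (_+ ∑ (adj x) (others I)) (∑-zero I (λ y∈ → adj≡0 (I-independent x∈ y∈))))

    deg≤|others| : x ∈ I → deg G x ≤ length (others I)
    deg≤|others| {x} x∈ = begin
      deg G x                 ≡⟨ deg≡∑-outside x∈ ⟩
      ∑ (adj x) (others I)    ≤⟨ ∑-bound (others I) (λ {y} _ → adj≤1 x y) ⟩
      length (others I) * 1   ≡⟨ *-identityʳ _ ⟩
      length (others I)       ∎
      where open ≤-Reasoning

    ∑-deg : ∑ (deg G) I ≡ ∑ (λ w → ∑ (adj w) I) (others I)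
    ∑-deg = begin
      ∑ (deg G) I                                   ≡⟨ ∑-cong I deg≡∑-outside ⟩
      ∑ (λ x → ∑ (adj x) (others I)) I              ≡⟨ ∑-swap adj I (others I) ⟩
      ∑ (λ w → ∑ (λ x → adj x w) I) (others I)      ≡⟨ ∑-cong (others I) (λ {w} _ → ∑-cong I (λ {x} _ → adj-sym x w)) ⟩
      ∑ (λ w → ∑ (adj w) I) (others I)              ∎
      where open ≡-Reasoning

    star-at : ∀ t w → t ≤ ∑ (adj w) I → HasInducedSubgraph G (K₁, t)
    star-at t w t≤ = subst (λ s → HasInducedSubgraph G (K₁, s)) |leaves|
      (star⇒induced (Uniqueₚ.take⁺ t (Uniqueₚ.filter⁺ (adj? G w) I-unique)) (proj₂ ∘ leaf⁻)
        (λ p q → I-independent (proj₁ (leaf⁻ p)) (proj₁ (leaf⁻ q))))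
      where
      leaves : List V
      leaves = take t (filter (adj? G w) I)
      |leaves| : length leaves ≡ t
      |leaves| = trans (length-take t (filter (adj? G w) I))
        (m≤n⇒m⊓n≡m (≤-trans t≤ (≤-reflexive (≡-sym (length-filter≡∑ (adj? G w) I)))))
      leaf⁻ : x ∈ leaves → x ∈ I × Adj G w x
      leaf⁻ {x} x∈ = ∈-filter⁻ (adj? G w) {xs = I}
        (subst (x ∈_) (take++drop≡id t (filter (adj? G w) I)) (∈-++⁺ˡ x∈))

  Conclusion : ℕ → ℕ → Set₁
  Conclusion t b = (n ≥ b) × (n > b → HasInducedSubgraph G (K₁, t)) ×
    (n ≡ b → Σ[ H ∈ Graph (Fin (t ∸ 3)) ] (G ≅ H ∨ edgeless (Fin (t ∸ 1))))

  module _ (connected : Connected G) (¬ham : ¬ HasHamiltonianPath G) (i : ℕ)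
           (ore : ∀ {x y} → x ≢ y → ¬ Adj G x y → (2 + i) * n ≤ (3 + i) * (deg G x + deg G y)) where

    σ₃≥n : x ≢ y → x ≢ w → y ≢ w → ¬ Adj G x y → ¬ Adj G x w → ¬ Adj G y w →
           n ≤ deg G x + (deg G y + deg G w)
    σ₃≥n {x} {y} {w} x≢y x≢w y≢w ¬xy ¬xw ¬yw = *-cancelˡ-≤ (2 * (3 + i)) (begin
      2 * (3 + i) * n                                               ≤⟨ m≤m+n _ (i * n) ⟩
      2 * (3 + i) * n + i * n                                       ≡⟨ lemma i n ⟩
      (2 + i) * n + ((2 + i) * n + (2 + i) * n)                     ≤⟨ +-mono-≤ (ore x≢y ¬xy) (+-mono-≤ (ore x≢w ¬xw) (ore y≢w ¬yw)) ⟩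
      (3 + i) * (dx + dy) + ((3 + i) * (dx + dw) + (3 + i) * (dy + dw))   ≡⟨ lemma′ (3 + i) dx dy dw ⟩
      2 * (3 + i) * (dx + (dy + dw))                                   ∎)
      where
      open ≤-Reasoning
      dx dy dw : ℕ
      dx = deg G x
      dy = deg G y
      dw = deg G w
      lemma : ∀ i n → 2 * (3 + i) * n + i * n ≡ (2 + i) * n + ((2 + i) * n + (2 + i) * n)
      lemma = solve-∀
      lemma′ : ∀ k a b c → k * (a + b) + (k * (a + c) + k * (b + c)) ≡ 2 * k * (a + (b + c))
      lemma′ = solve-∀

    module _ {Z : List V} (C : Cycle Z) (longest : Longest (suc (length Z)))
             {u v : V} (u∉ : u ∉ Z) (v∉ : v ∉ Z) (u≢v : u ≢ v) (degrees : deg G u ≤ deg G v) where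

      open OffCycle connected C longest u∉ v∉ u≢v
      open At v∉

      private
        U : List V
        U = others Z

        u∈ : u ∈ I
        u∈ = ∈-++⁺ˡ (∈-others⁺ u∉)

        v∈ : v ∈ I
        v∈ = ∈-++⁺ˡ (∈-others⁺ v∉)

        2≤|U| : 2 ≤ length U
        2≤|U| = length-⊆ {xs = u ∷ v ∷ []} ((u≢v ∷ []) ∷ [] ∷ [])
          λ { (here refl) → ∈-others⁺ u∉ ; (there (here refl)) → ∈-others⁺ v∉ }

        n≡ : length U + deg G v + length W ≡ n
        n≡ = trans (cong (_+ length W) (≡-sym |I|)) (length-others I-unique)

        deg-v : (2 + i) * n ≤ 2 * (3 + i) * deg G v
        deg-v = begin
          (2 + i) * n                      ≤⟨ ore u≢v (I-independent u∈ v∈) ⟩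
          (3 + i) * (deg G u + deg G v)    ≤⟨ *-monoʳ-≤ (3 + i) (+-monoˡ-≤ (deg G v) degrees) ⟩
          (3 + i) * (deg G v + deg G v)    ≡⟨ lemma (3 + i) (deg G v) ⟩
          2 * (3 + i) * deg G v            ∎
          where
          open ≤-Reasoning
          lemma : ∀ a b → a * (b + b) ≡ 2 * a * b
          lemma = solve-∀

        deg-v≤|W| : deg G v ≤ length W
        deg-v≤|W| = deg≤|others| I-unique I-independent v∈

        lower : (length U + deg G v) * ((2 + i) * n) ≤ 2 * ((3 + i) * ∑ (deg G) I)
        lower = begin
          (length U + deg G v) * ((2 + i) * n)     ≡⟨ cong (_* ((2 + i) * n)) |I| ⟨
          length I * ((2 + i) * n)                ≤⟨ pairwise-∑ (λ x → (3 + i) * deg G x) _ I |I|≢1 I-unique pairs ⟩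
          2 * ∑ (λ x → (3 + i) * deg G x) I       ≡⟨ cong (2 *_) (∑-* (3 + i) (deg G) I) ⟩
          2 * ((3 + i) * ∑ (deg G) I)             ∎
          where
          open ≤-Reasoning
          |I|≢1 : length I ≢ 1
          |I|≢1 eq = <⇒≱ 2≤|U| (subst (length U ≤_) (trans (≡-sym |I|) eq) (m≤m+n _ _))
          pairs : ∀ {x y} → x ∈ I → y ∈ I → x ≢ y → (2 + i) * n ≤ (3 + i) * deg G x + (3 + i) * deg G y
          pairs {x} {y} x∈ y∈ x≢y =
            ≤-trans (ore x≢y (I-independent x∈ y∈)) (≤-reflexive (*-distribˡ-+ (3 + i) (deg G x) (deg G y)))

      star : 6 + 2 * i < n → HasInducedSubgraph G (K₁, (5 + i))
      star n> with any? (λ w → 5 + i ≤? ∑ (adj w) I) W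
      ... | yes a with find a
      ...   | w , _ , t≤ = star-at I-unique I-independent (5 + i) w t≤
      star n> | no ∄ = ⊥-elim contradiction
        where
        few : ∀ {w} → w ∈ W → ∑ (adj w) I ≤ 4 + i
        few w∈ = s≤s⁻¹ (≰⇒> (λ t≤ → ∄ (lose w∈ t≤)))
        exceptional : Exceptional i n (deg G v) (length U)
        exceptional = few-exceptions i n deg-v 2≤|U| n≡ n> lower
          (≤-trans (≤-reflexive (∑-deg I-unique I-independent)) (∑-bound W few))
        contradiction : ⊥
        contradiction with exceptional-gap exceptional (length-others (Cycle.unique C))
        ... | gap , nonempty with sparse-vertex gap nonempty
        ...   | w , w∈ , w≤ = exceptions-impossible exceptional n≡ (length-others (Cycle.unique C)) lower
                (≤-trans (+-monoˡ-≤ (4 + i) (≤-reflexive (∑-deg I-unique I-independent))) (∑-bound-at W few w∈)) w≤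

      join : n ≡ 6 + 2 * i → Σ[ H ∈ Graph (Fin (2 + i)) ] (G ≅ H ∨ edgeless (Fin (4 + i)))
      join n≡2k = subst₂ (λ a b → Σ[ H ∈ Graph (Fin a) ] (G ≅ H ∨ edgeless (Fin b)))
        |W|≡ (trans |I| (proj₁ orders)) (join-decomposition I-unique I-independent complete)
        where
        orders : length U + deg G v ≡ 4 + i × length W ≡ 2 + i
        orders = order≡2k i (subst (λ n → (2 + i) * n ≤ 2 * (3 + i) * deg G v) n≡2k deg-v)
          2≤|U| (trans n≡ n≡2k) deg-v≤|W|
        |W|≡ : length W ≡ 2 + i
        |W|≡ = proj₂ orders
        partner : ∀ x → ∃[ y ] (y ∈ I × x ≢ y)
        partner x with x ≟ᶠ u
        ... | no x≢u   = u , u∈ , x≢u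
        ... | yes refl = v , v∈ , u≢v
        deg≤ : x ∈ I → deg G x ≤ 2 + i
        deg≤ x∈ = ≤-trans (deg≤|others| I-unique I-independent x∈) (≤-reflexive |W|≡)
        deg≥ : x ∈ I → 2 + i ≤ deg G x
        deg≥ {x} x∈ with partner x
        ... | y , y∈ , x≢y = +-cancelʳ-≤ (2 + i) _ _ (*-cancelˡ-≤ (3 + i) (begin
          (3 + i) * (2 + i + (2 + i))      ≡⟨ lemma i ⟩
          (2 + i) * (6 + 2 * i)            ≡⟨ cong ((2 + i) *_) n≡2k ⟨
          (2 + i) * n                      ≤⟨ ore x≢y (I-independent x∈ y∈) ⟩
          (3 + i) * (deg G x + deg G y)    ≤⟨ *-monoʳ-≤ (3 + i) (+-monoʳ-≤ (deg G x) (deg≤ y∈)) ⟩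
          (3 + i) * (deg G x + (2 + i))    ∎))
          where
          open ≤-Reasoning
          lemma : ∀ i → (3 + i) * (2 + i + (2 + i)) ≡ (2 + i) * (6 + 2 * i)
          lemma = solve-∀
        complete : ∀ {x y} → x ∈ I → y ∈ W → Adj G x y
        complete {x} x∈ = ∑-full (adj? G x) W
          (≤-trans (≤-reflexive |W|≡) (≤-trans (deg≥ x∈) (≤-reflexive (deg≡∑-outside I-unique I-independent x∈))))

      cycle⇒conclusion : Conclusion (5 + i) (6 + 2 * i)
      cycle⇒conclusion = order≥2k i deg-v 2≤|U| n≡ deg-v≤|W| , star , join

    conclusion : Conclusion (5 + i) (6 + 2 * i)
    conclusion = go (missed-vertex ¬ham seg unique)
      where
      open LongestPath (longest-path (proj₁ connected))
      go : ∃[ v ] v ∉ vertices → Conclusion (5 + i) (6 + 2 * i)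
      go (v , v∉) with shorter-cycle connected longest seg unique refl v∉ σ₃≥n
      ... | Z , C , |Z|+1≡ = two-off (others Z) (others-unique Z) ∈-others⁻ 2≤|U|
        where
        longest′ : Longest (suc (length Z))
        longest′ = subst Longest (≡-sym |Z|+1≡) longest
        2≤|U| : 2 ≤ length (others Z)
        2≤|U| = +-cancelˡ-≤ (length Z) _ _ (begin
          length Z + 2                                ≡⟨ +-comm (length Z) 2 ⟩
          2 + length Z                                ≡⟨ cong suc |Z|+1≡ ⟩
          suc (length vertices)                       ≡⟨ +-comm 1 _ ⟩
          length vertices + 1                         ≤⟨ +-monoʳ-≤ (length vertices) 1≤|off| ⟩
          length vertices + length (others vertices)  ≡⟨ length-others unique ⟩
          n                                           ≡⟨ length-others (Cycle.unique C) ⟨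
          length Z + length (others Z)                ∎)
          where
          open ≤-Reasoning
          1≤|off| : 1 ≤ length (others vertices)
          1≤|off| = length-⊆ {xs = v ∷ []} ([] ∷ []) λ { (here refl) → ∈-others⁺ v∉ }
        two-off : ∀ U → Unique U → (∀ {x} → x ∈ U → x ∉ Z) → 2 ≤ length U → Conclusion (5 + i) (6 + 2 * i)
        two-off (u ∷ w ∷ _) ((u≢w ∷ _) ∷ _) off _ with ≤-total (deg G u) (deg G w)
        ... | inj₁ u≤w = cycle⇒conclusion C longest′ (off (here refl)) (off (there (here refl))) u≢w u≤w
        ... | inj₂ w≤u = cycle⇒conclusion C longest′ (off (there (here refl))) (off (here refl)) (u≢w ∘ ≡-sym) w≤u
        two-off (_ ∷ []) _ _ (s≤s ())

  σ₂≤ : ∀ {x y} → x ≢ y → ¬ Adj G x y → σ₂ G ≤⁺ [ deg G x + deg G y ]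
  σ₂≤ {x} {y} x≢y ¬xy = All.lookup (Extrema.min≤xs ℕ⁺-totalOrder ⊤⁺ _)
    (∈-map⁺ (λ (x , y) → [ deg G x + deg G y ])
      (∈-filter⁺ (λ (x , y) → ¬? (x ≟ᶠ y) ×-dec ¬? (adj? G x y))
        (∈-cartesianProduct⁺ (∈-allFin x) (∈-allFin y)) (x≢y , ¬xy)))

  σ₂-bound : ∀ {a} k → [ a ] ≤⁺ Maybe.map (k *_) (σ₂ G) →
             ∀ {x y} → x ≢ y → ¬ Adj G x y → a ≤ k * (deg G x + deg G y)
  σ₂-bound {a} k h x≢y ¬xy = go (σ₂ G) h (σ₂≤ x≢y ¬xy)
    where
    go : ∀ s {b} → [ a ] ≤⁺ Maybe.map (k *_) s → s ≤⁺ [ b ] → a ≤ k * b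
    go [ _ ] a≤ l≤ = ≤-trans ([≤]-injective a≤) (*-monoʳ-≤ k ([≤]-injective l≤))

theorem3 : ∀ (t : ℕ) → t ≥ 5 → ∀ (n : ℕ) (G : Graph (Fin n)) →
    Connected G →
    [ (t ∸ 3) * n ] ≤⁺ Maybe.map ((t ∸ 2) *_) (σ₂ G) →
    ¬ HasHamiltonianPath G →
    (n ≥ 2 * t ∸ 4) ×
    (n > 2 * t ∸ 4 → HasInducedSubgraph G (K₁, t)) ×
    (n ≡ 2 * t ∸ 4 → Σ[ H ∈ Graph (Fin (t ∸ 3)) ] (G ≅ H ∨ edgeless (Fin (t ∸ 1))))
theorem3 (suc (suc (suc (suc (suc i))))) (s≤s (s≤s (s≤s (s≤s (s≤s _))))) n G connected σ₂≥ ¬ham =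
  subst (Conclusion G (5 + i)) (lemma i) (conclusion G connected ¬ham i (σ₂-bound G (3 + i) σ₂≥))
  where
  lemma : ∀ i → 6 + 2 * i ≡ 1 + (i + (5 + i + 0))
  lemma = solve-∀
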